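{- Let $n>0$. Then the poset $(\mathcal{W}(B_n),\leqslant_R)$ is isomorphic to the product poset $(B_{\lceil n/2\rceil},\leqslant_R)\times\mathcal{P}([\lfloor n/2\rfloor])$, where $\mathcal{P}([\lfloor n/2\rfloor])$ is ordered by inclusion. In particular, $(\mathcal{W}(B_n),\leqslant_R)$ is a complemented lattice.
   Context: For $k\ge1$, $B_k$ is the group of bijections $w$ of $[\pm k]=\{ -k,\dots,-1,1,\dots,k\}$ with $w(-a)=-w(a)$; it is a Coxeter group with simple generators $S=\{(1,-1)\}\cup\{(a,a+1)(-a,-a-1):a\in[k-1]\}$ and length $\ell_B$. The right weak order $\leqslant_R$ is the partial order on $B_k$ generated by the covers $u\vartriangleleft_R us$ for $s\in S$ with $\ell_B(us)=\ell_B(u)+1$. For $a\in[n]$ let $a^*=a-1$ if $a$ even, $a^*=a+1$ if $a$ odd and $a+1\le n$, $a^*=n$ otherwise. The signed Wachs permutations are $\mathcal{W}(B_n)=\{v\in B_n: |v^{ -1}(a)-v^{ -1}(a^*)|\le1\ \forall a\in[n-1]\}$, ordered by the restriction of $\leqslant_R$ on $B_n$. -}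

module Defs where

open import Data.Nat as ℕ using (ℕ; zero; suc; _≤_; _<_; _≟_; ⌊_/2⌋; ⌈_/2⌉)
open import Data.Integer as ℤ using (ℤ; +_; -[1+_]; ∣_∣; -_; _-_)
open import Data.Fin using (Fin; toℕ)
open import Data.Fin.Subset using (Subset; _⊆_)
open import Data.Vec using (Vec; []; _∷_; tabulate)
open import Data.List using (List; []; _∷_; foldl; length)
open import Data.List.Relation.Unary.All using (All)
open import Data.Product using (Σ; ∃; _×_; _,_; proj₁)
open import Data.Bool using (Bool; true; false; if_then_else_)
open import Relation.Nullary using (¬_; Dec; yes; no)
open import Relation.Nullary.Decidable using (⌊_⌋)
open import Relation.Binary.PropositionalEquality using (_≡_; _≢_)
open import Relation.Binary.Construct.Closure.ReflexiveTransitive using (Star)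
open import Function.Bundles using (_⇔_)

InPM : ℕ → ℤ → Set
InPM k a = (a ≢ + 0) × (∣ a ∣ ≤ k)

-- A signed permutation w of [±k] is stored by its window
-- (w(1),…,w(k)) : Vec ℤ k; its action on ℤ is extended by w(-a) = -w(a)
-- (and w(0) = 0, outside [±k] the value is irrelevant).

nth : ∀ {k} → Vec ℤ k → ℕ → ℤ
nth []       _       = + 0
nth (x ∷ xs) zero    = x
nth (x ∷ xs) (suc i) = nth xs i

app : ∀ {k} → Vec ℤ k → ℤ → ℤ
app w (+ zero)    = + 0
app w (+ suc i)   = nth w i
app w -[1+ i ]    = - nth w i

-- w is a bijection of [±k] (oddness w(-a) = -w(a) holds by construction)
IsSignedPerm : (k : ℕ) → Vec ℤ k → Set
IsSignedPerm k w =
  (∀ a → InPM k a → InPM k (app w a)) ×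
  (∀ a b → InPM k a → InPM k b → app w a ≡ app w b → a ≡ b) ×
  (∀ b → InPM k b → ∃ λ a → InPM k a × app w a ≡ b)

_·_ : ∀ {k} → Vec ℤ k → Vec ℤ k → Vec ℤ k
u · w = tabulate (λ i → app u (app w (+ suc (toℕ i))))

idB : (k : ℕ) → Vec ℤ k
idB k = tabulate (λ i → + suc (toℕ i))

-- simple generators, indexed by j < k:
--   j = 0     : (1,-1)
--   j = a ≥ 1 : (a,a+1)(-a,-a-1)
genWin : ℕ → ℕ → ℤ
genWin zero p = if ⌊ p ≟ 1 ⌋ then -[1+ 0 ] else + p
genWin (suc a) p =
  if ⌊ p ≟ suc a ⌋ then + suc (suc a)
  else if ⌊ p ≟ suc (suc a) ⌋ then + suc a
  else + p

gen : (k : ℕ) → ℕ → Vec ℤ k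
gen k j = tabulate (λ i → genWin j (suc (toℕ i)))

evalWord : (k : ℕ) → List ℕ → Vec ℤ k
evalWord k js = foldl (λ w j → w · gen k j) (idB k) js

IsWord : (k : ℕ) → List ℕ → Set
IsWord k js = All (λ j → j < k) js

HasLength : (k : ℕ) → Vec ℤ k → ℕ → Set
HasLength k w m =
  (∃ λ js → IsWord k js × evalWord k js ≡ w × length js ≡ m) ×
  (∀ js → IsWord k js → evalWord k js ≡ w → m ≤ length js)

CoverR : (k : ℕ) → Vec ℤ k → Vec ℤ k → Set
CoverR k u v =
  ∃ λ j → j < k × v ≡ u · gen k j ×
    (∃ λ m → HasLength k u m × HasLength k v (suc m))

≤R : (k : ℕ) → Vec ℤ k → Vec ℤ k → Set
≤R k u v = Star (CoverR k) u v

star : ℕ → ℕ → ℕ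
star n a with ⌊ a /2⌋ ℕ.* 2 ≟ a
... | yes _ = a ℕ.∸ 1
... | no  _ = if ⌊ suc a ℕ.≤? n ⌋ then suc a else n

IsWachs : (n : ℕ) → Vec ℤ n → Set
IsWachs n v =
  IsSignedPerm n v ×
  (∀ a → 1 ≤ a → a ≤ n ℕ.∸ 1 →
     ∀ x y → InPM n x → InPM n y →
       app v x ≡ + a → app v y ≡ + star n a → ∣ x - y ∣ ≤ 1)

record SubposetIso {A B : Set} (P : A → Set) (_≤A_ : A → A → Set)
                   (Q : B → Set) (_≤B_ : B → B → Set) : Set where
  field
    to       : A → B
    from     : B → A
    to-Q     : ∀ a → P a → Q (to a)
    from-P   : ∀ b → Q b → P (from b)
    from-to  : ∀ a → P a → from (to a) ≡ a
    to-from  : ∀ b → Q b → to (from b) ≡ b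
    mono     : ∀ a a′ → P a → P a′ → (a ≤A a′) ⇔ (to a ≤B to a′)

module _ {A : Set} (P : A → Set) (_≤_ : A → A → Set) where

  IsMeet : A → A → A → Set
  IsMeet x y m = P m × m ≤ x × m ≤ y × (∀ z → P z → z ≤ x → z ≤ y → z ≤ m)

  IsJoin : A → A → A → Set
  IsJoin x y j = P j × x ≤ j × y ≤ j × (∀ z → P z → x ≤ z → y ≤ z → j ≤ z)

  IsComplementedLattice : Set
  IsComplementedLattice =
    (∀ x y → P x → P y → ∃ λ m → IsMeet x y m) ×
    (∀ x y → P x → P y → ∃ λ j → IsJoin x y j) ×
    (∃ λ bot → ∃ λ top →
       P bot × P top × (∀ x → P x → bot ≤ x) × (∀ x → P x → x ≤ top) ×
       (∀ x → P x → ∃ λ y → P y × IsMeet x y bot × IsJoin x y top))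

ProdCarrier : ℕ → ℕ → Set
ProdCarrier k m = Vec ℤ k × Subset m

InProd : (k m : ℕ) → ProdCarrier k m → Set
InProd k m (w , _) = IsSignedPerm k w

≤Prod : (k m : ℕ) → ProdCarrier k m → ProdCarrier k m → Set
≤Prod k m (u , X) (v , Y) = ≤R k u v × (X ⊆ Y)

{-# OPTIONS --safe #-}

-- A signed permutation w is encoded by the order in which the values of [±k]
-- occur in w(-k), …, w(k); these are exactly the total orders T on [±k] with
-- a T b ⇔ -b T -a.  If every inversion of u is one of T, then either u sorts
-- T or some generator exchanges two neighbours of u that are increasing as
-- integers but decreasing in T; iterating, u climbs in the weak order to the
-- permutation of T.  Hence ≤R is inclusion of inversion sets, and any odd
-- total order is realised by a signed permutation.
--
-- The join of u and v has as inversion set the transitive closure of the union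
-- of theirs; meets and complements come from w ↦ -w, which complements the
-- inversion set.
--
-- In a Wachs permutation every other value lies on the same side of 2i-1 and
-- 2i, so its inversions are determined by those of the induced order on blocks
-- together with the set of i such that 2i precedes 2i-1.
module Submission where

open import Defs
open import Data.Bool using (Bool; true; false; if_then_else_)
open import Data.Empty using (⊥)
open import Data.Fin as Fin using (Fin; toℕ; fromℕ<)
open import Data.Fin.Properties using (any?; toℕ-fromℕ<; toℕ<n)
open import Data.Fin.Subset as Subset using (Subset; _∈_; _⊆_; _∩_; _∪_; ∁)
open import Data.Fin.Subset.Properties using (p∩q⊆p; p∩q⊆q; x∈p∩q⁺; p⊆p∪q; q⊆p∪q; x∈p∪q⁻; ⊥⊆; ⊆⊤; ∈⊤; p∪∁p≡⊤; x∈∁p⇒x∉p)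
open import Data.Integer using (ℤ; +_; -[1+_]; ∣_∣; -_; _+_; _-_; _≤_; _<_; _≟_; _<?_; +<+; -<-; -<+; +≤+; -≤+; -≤-)
open import Data.Integer.Properties as ℤ using (neg-involutive; neg-mono-<; <-cmp; <-trans; <-asym; <-irrefl; ∣-i∣≡∣i∣)
open import Data.List using ([]; _∷_; foldl; length)
open import Data.List.Relation.Unary.All using ([]; _∷_)
open import Data.Nat as ℕ using (ℕ; zero; suc; z≤n; s≤s; ⌊_/2⌋; ⌈_/2⌉)
import Data.Nat.Properties as ℕ
open import Data.Nat.Tactic.RingSolver using (solve-∀)
open import Data.Product using (∃; _×_; _,_; proj₁; proj₂)
open import Data.Sum as Sum using (_⊎_; inj₁; inj₂)
open import Data.Vec as Vec using (Vec; []; _∷_; tabulate; lookup)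
open import Data.Vec.Properties using (lookup∘tabulate; tabulate∘lookup; tabulate-cong; []=⇒lookup; lookup⇒[]=)
open import Function using (_∘_; id; flip)
open import Function.Bundles using (Equivalence; mk⇔)
open import Relation.Binary.Construct.Closure.ReflexiveTransitive using (Star; ε; _◅_)
open import Relation.Binary.Construct.Closure.Transitive using (TransClosure; [_]; _∷_; _∷ʳ_; _++_)
open import Relation.Binary.Definitions using (tri<; tri≈; tri>)
open import Relation.Binary.PropositionalEquality hiding ([_])
open import Relation.Nullary using (¬_; Dec; yes; no; contradiction)
open import Relation.Nullary.Decidable as Dec using (⌊_⌋; does; dec-true; dec-false; _×-dec_; _⊎-dec_; ¬?)

-- Covers of `≤R` are defined through lengths of shortest words, so inversion sets describe the
-- order only once the inversion count `invB` is known to be the length. Sorting supplies this too: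
-- started at the identity it yields a word with `invB u` letters, and no word is shorter because a
-- generator changes `invB` by one.
--
-- An inversion set is transitive, and so is its complement among increasing pairs. The transitive
-- closure of a union secures the first property; the second has to survive the closure, and it does
-- because a chain from a to c with a < b < c either visits b or has exactly one link jumping over
-- b.
--
-- The product arises because values of different blocks compare as integers in the same way as
-- their blocks. An inversion of a Wachs permutation is therefore either an inversion of two blocks
-- or a flip inside one block, and the two kinds can be chosen independently.
--
-- Sorting is a computation, so every order fed to it has to be decidable; for the transitive
-- closure this is a bounded search.

private variable k : ℕ

-- Oddness and extensionality of windows

neg-InPM : ∀ {a} → InPM k a → InPM k (- a)
neg-InPM {a = + zero}   p       = p
neg-InPM {a = + suc _}  (_ , p) = (λ ()) , p
neg-InPM {a = -[1+ _ ]} (_ , p) = (λ ()) , p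

neg-≡ : ∀ {x y} → - x ≡ y → x ≡ - y
neg-≡ {x} refl = sym (neg-involutive x)

app-neg : (u : Vec ℤ k) (x : ℤ) → app u (- x) ≡ - app u x
app-neg u (+ zero)   = refl
app-neg u (+ suc i)  = refl
app-neg u -[1+ i ]   = sym (neg-involutive _)

nth-tabulate : (f : Fin k → ℤ) (i : Fin k) → nth (tabulate f) (toℕ i) ≡ f i
nth-tabulate f Fin.zero    = refl
nth-tabulate f (Fin.suc i) = nth-tabulate (f ∘ Fin.suc) i

nth-ext : (u v : Vec ℤ k) → (∀ i → i ℕ.< k → nth u i ≡ nth v i) → u ≡ v
nth-ext []      []      h = refl
nth-ext (x ∷ u) (y ∷ v) h =
  cong₂ _∷_ (h 0 (s≤s z≤n)) (nth-ext u v (λ i i<k → h (suc i) (s≤s i<k)))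

nth-tabulate< : (f : ℕ → ℤ) {i : ℕ} → i ℕ.< k → nth (tabulate {n = k} (f ∘ toℕ)) i ≡ f i
nth-tabulate< {k} f {i} i<k = begin
  nth (tabulate {n = k} (f ∘ toℕ)) i                    ≡⟨ cong (nth (tabulate {n = k} (f ∘ toℕ))) (toℕ-fromℕ< i<k) ⟨
  nth (tabulate {n = k} (f ∘ toℕ)) (toℕ (fromℕ< i<k))   ≡⟨ nth-tabulate (f ∘ toℕ) (fromℕ< i<k) ⟩
  f (toℕ (fromℕ< i<k))                                  ≡⟨ cong f (toℕ-fromℕ< i<k) ⟩
  f i                                                   ∎
  where open ≡-Reasoning

-- Generators acting on positions

swap : ℕ → ℕ → ℕ
swap zero    zero          = 1
swap zero    (suc zero)    = 0
swap zero    (suc (suc n)) = suc (suc n)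
swap (suc a) zero          = zero
swap (suc a) (suc n)       = suc (swap a n)

-- The generator `genWin j` by structural recursion, extended oddly to negative positions. `swap a`
-- works on indices counted from 0, hence the `suc` around it.
σ : ℕ → ℤ → ℤ
σ zero    (+ zero)        = + zero
σ zero    (+ suc zero)    = -[1+ zero ]
σ zero    (+ suc (suc n)) = + suc (suc n)
σ zero    -[1+ zero ]     = + suc zero
σ zero    -[1+ suc n ]    = -[1+ suc n ]
σ (suc a) (+ zero)        = + zero
σ (suc a) (+ suc n)       = + suc (swap a n)
σ (suc a) -[1+ n ]        = -[1+ swap a n ]

-- σ j exchanges the neighbours lo j < hi j (and their negatives).
lo hi : ℕ → ℤ
lo zero    = -[1+ zero ]
lo (suc a) = + suc a
hi zero    = + suc zero
hi (suc a) = + suc (suc a)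

lo<hi : ∀ j → lo j < hi j
lo<hi zero    = -<+
lo<hi (suc a) = +<+ ℕ.≤-refl

lo-InPM : ∀ {j} → j ℕ.< k → InPM k (lo j)
lo-InPM {j = zero}  p = (λ ()) , p
lo-InPM {j = suc a} p = (λ ()) , ℕ.<⇒≤ p

hi-InPM : ∀ {j} → j ℕ.< k → InPM k (hi j)
hi-InPM {j = zero}  p = (λ ()) , p
hi-InPM {j = suc a} p = (λ ()) , p

swap-lower : ∀ a → swap a a ≡ suc a
swap-lower zero    = refl
swap-lower (suc a) = cong suc (swap-lower a)

swap-upper : ∀ a → swap a (suc a) ≡ a
swap-upper zero    = refl
swap-upper (suc a) = cong suc (swap-upper a)

swap-fixed : ∀ a n → n ≢ a → n ≢ suc a → swap a n ≡ n
swap-fixed zero    zero          p q = contradiction refl p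
swap-fixed zero    (suc zero)    p q = contradiction refl q
swap-fixed zero    (suc (suc n)) p q = refl
swap-fixed (suc a) zero          p q = refl
swap-fixed (suc a) (suc n)       p q = cong suc (swap-fixed a n (p ∘ cong suc) (q ∘ cong suc))

swap-involutive : ∀ a n → swap a (swap a n) ≡ n
swap-involutive zero    zero          = refl
swap-involutive zero    (suc zero)    = refl
swap-involutive zero    (suc (suc n)) = refl
swap-involutive (suc a) zero          = refl
swap-involutive (suc a) (suc n)       = cong suc (swap-involutive a n)

swap-< : ∀ {a n} → suc a ℕ.< k → n ℕ.< k → swap a n ℕ.< k
swap-< {a = zero}  {zero}        p       q       = p
swap-< {a = zero}  {suc zero}    p       q       = ℕ.<-trans ℕ.≤-refl p
swap-< {a = zero}  {suc (suc n)} p       q       = q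
swap-< {a = suc a} {zero}        p       q       = q
swap-< {a = suc a} {suc n}       (s≤s p) (s≤s q) = s≤s (swap-< p q)

swap-mono : ∀ a {m n} → m ℕ.< n → swap a m ℕ.< swap a n ⊎ (m ≡ a × n ≡ suc a)
swap-mono zero    {zero}        {suc zero}    p       = inj₂ (refl , refl)
swap-mono zero    {zero}        {suc (suc n)} p       = inj₁ (s≤s (s≤s z≤n))
swap-mono zero    {suc zero}    {suc (suc n)} p       = inj₁ (s≤s z≤n)
swap-mono zero    {suc (suc m)} {suc (suc n)} p       = inj₁ p
swap-mono zero    {suc _}       {suc zero}    (s≤s ())
swap-mono (suc a) {zero}        {suc n}       p       = inj₁ (s≤s z≤n)
swap-mono (suc a) {suc m}       {suc n}       (s≤s p) with swap-mono a p
... | inj₁ q             = inj₁ (s≤s q)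
... | inj₂ (refl , refl) = inj₂ (refl , refl)

σ-neg : ∀ j x → σ j (- x) ≡ - σ j x
σ-neg zero    (+ zero)        = refl
σ-neg zero    (+ suc zero)    = refl
σ-neg zero    (+ suc (suc n)) = refl
σ-neg zero    -[1+ zero ]     = refl
σ-neg zero    -[1+ suc n ]    = refl
σ-neg (suc a) (+ zero)        = refl
σ-neg (suc a) (+ suc n)       = refl
σ-neg (suc a) -[1+ n ]        = refl

σ-involutive : ∀ j x → σ j (σ j x) ≡ x
σ-involutive zero    (+ zero)        = refl
σ-involutive zero    (+ suc zero)    = refl
σ-involutive zero    (+ suc (suc n)) = refl
σ-involutive zero    -[1+ zero ]     = refl
σ-involutive zero    -[1+ suc n ]    = refl
σ-involutive (suc a) (+ zero)        = refl
σ-involutive (suc a) (+ suc n)       = cong (+_ ∘ suc) (swap-involutive a n)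
σ-involutive (suc a) -[1+ n ]        = cong -[1+_] (swap-involutive a n)

σ-lo : ∀ j → σ j (lo j) ≡ hi j
σ-lo zero    = refl
σ-lo (suc a) = cong (+_ ∘ suc) (swap-lower a)

σ-hi : ∀ j → σ j (hi j) ≡ lo j
σ-hi zero    = refl
σ-hi (suc a) = cong (+_ ∘ suc) (swap-upper a)

σ-InPM : ∀ j {x} → j ℕ.< k → InPM k x → InPM k (σ j x)
σ-InPM zero    {+ zero}        j<k p       = p
σ-InPM zero    {+ suc zero}    j<k (_ , p) = (λ ()) , p
σ-InPM zero    {+ suc (suc n)} j<k p       = p
σ-InPM zero    { -[1+ zero ]}  j<k (_ , p) = (λ ()) , p
σ-InPM zero    { -[1+ suc n ]} j<k p       = p
σ-InPM (suc a) {+ zero}        j<k p       = p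
σ-InPM (suc a) {+ suc n}       j<k (_ , p) = (λ ()) , swap-< j<k p
σ-InPM (suc a) { -[1+ n ]}     j<k (_ , p) = (λ ()) , swap-< j<k p

-- A simple generator exchanges neighbours, so only the exchanged pair and its negative change their
-- order; for `j = 0` these two pairs coincide. Position 0 must be excluded, because `σ zero`
-- carries -1 past it.
σ-mono : ∀ j {x y} → InPM k x → InPM k y → x < y →
  σ j x < σ j y ⊎ (x ≡ lo j × y ≡ hi j) ⊎ (x ≡ - hi j × y ≡ - lo j)
σ-mono j       {+ zero}  (x≢0 , _) py x<y = contradiction refl x≢0
σ-mono j       {y = + zero} px (y≢0 , _) x<y = contradiction refl y≢0
σ-mono zero    {+ suc zero}    {+ suc (suc n)} px py p = inj₁ -<+
σ-mono zero    {+ suc (suc m)} {+ suc (suc n)} px py p = inj₁ p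
σ-mono zero    {+ suc m}       {+ suc zero}    px py (+<+ (s≤s ()))
σ-mono zero    { -[1+ zero ]}  {+ suc zero}    px py p = inj₂ (inj₁ (refl , refl))
σ-mono zero    { -[1+ zero ]}  {+ suc (suc n)} px py p = inj₁ (+<+ (s≤s (s≤s z≤n)))
σ-mono zero    { -[1+ suc m ]} {+ suc zero}    px py p = inj₁ (-<- (s≤s z≤n))
σ-mono zero    { -[1+ suc m ]} {+ suc (suc n)} px py p = inj₁ -<+
σ-mono zero    { -[1+ suc m ]} { -[1+ zero ]}  px py p = inj₁ -<+
σ-mono zero    { -[1+ suc m ]} { -[1+ suc n ]} px py p = inj₁ p
σ-mono zero    { -[1+ zero ]}  { -[1+ n ]}     px py (-<- ())
σ-mono (suc a) {+ suc m}       {+ suc n}       px py (+<+ (s≤s p)) with swap-mono a p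
... | inj₁ q             = inj₁ (+<+ (s≤s q))
... | inj₂ (refl , refl) = inj₂ (inj₁ (refl , refl))
σ-mono (suc a) { -[1+ m ]}     {+ suc n}       px py p = inj₁ -<+
σ-mono (suc a) { -[1+ m ]}     { -[1+ n ]}     px py (-<- p) with swap-mono a p
... | inj₁ q             = inj₁ (-<- q)
... | inj₂ (refl , refl) = inj₂ (inj₂ (refl , refl))

genWin-σ : ∀ j i → genWin j (suc i) ≡ σ j (+ suc i)
genWin-σ zero    zero    = refl
genWin-σ zero    (suc i) = refl
genWin-σ (suc a) i with suc i ℕ.≟ suc a | suc i ℕ.≟ suc (suc a)
... | yes refl | _        = cong (+_ ∘ suc) (sym (swap-lower a))
... | no _     | yes refl = cong (+_ ∘ suc) (sym (swap-upper a))
... | no p     | no q     = cong (+_ ∘ suc) (sym (swap-fixed a i (p ∘ cong suc) (q ∘ cong suc)))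

-- Generators acting on windows

swapAt : ℕ → Vec ℤ k → Vec ℤ k
swapAt zero    (x ∷ y ∷ u) = y ∷ x ∷ u
swapAt (suc a) (x ∷ u)     = x ∷ swapAt a u
swapAt _       u           = u

-- Right multiplication by a generator acts on positions, hence on at most two neighbouring window
-- entries. In this recursive form `invB` unfolds along the window, which it does not do for the
-- tabulated product.
step : ℕ → Vec ℤ k → Vec ℤ k
step zero    (x ∷ u) = - x ∷ u
step zero    []      = []
step (suc a) u       = swapAt a u

nth-swapAt : ∀ a (u : Vec ℤ k) → suc a ℕ.< k → ∀ i → nth (swapAt a u) i ≡ nth u (swap a i)
nth-swapAt zero    (x ∷ y ∷ u) p       zero          = refl
nth-swapAt zero    (x ∷ y ∷ u) p       (suc zero)    = refl
nth-swapAt zero    (x ∷ y ∷ u) p       (suc (suc i)) = refl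
nth-swapAt zero    (x ∷ [])    (s≤s ()) i
nth-swapAt (suc a) (x ∷ u)     p       zero          = refl
nth-swapAt (suc a) (x ∷ u)     (s≤s p) (suc i)       = nth-swapAt a u p i

nth-step : ∀ j (u : Vec ℤ k) → j ℕ.< k → ∀ i → nth (step j u) i ≡ app u (σ j (+ suc i))
nth-step zero    (x ∷ u) p zero    = refl
nth-step zero    (x ∷ u) p (suc i) = refl
nth-step (suc a) u       p i       = nth-swapAt a u p i

app-step : ∀ j (u : Vec ℤ k) → j ℕ.< k → ∀ x → app (step j u) x ≡ app u (σ j x)
app-step zero    u j<k (+ zero)  = refl
app-step (suc _) u j<k (+ zero)  = refl
app-step j       u j<k (+ suc i) = nth-step j u j<k i
app-step j       u j<k -[1+ i ]  = begin
  - nth (step j u) i         ≡⟨ cong -_ (nth-step j u j<k i) ⟩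
  - app u (σ j (+ suc i))    ≡⟨ app-neg u (σ j (+ suc i)) ⟨
  app u (- σ j (+ suc i))    ≡⟨ cong (app u) (σ-neg j (+ suc i)) ⟨
  app u (σ j -[1+ i ])       ∎
  where open ≡-Reasoning

·-gen : ∀ j (u : Vec ℤ k) → j ℕ.< k → u · gen k j ≡ step j u
·-gen {k} j u j<k = nth-ext _ _ λ i i<k → begin
  nth (u · gen k j) i                   ≡⟨ nth-tabulate< (λ i → app u (nth (gen k j) i)) i<k ⟩
  app u (nth (gen k j) i)               ≡⟨ cong (app u) (nth-tabulate< (λ i → genWin j (suc i)) i<k) ⟩
  app u (genWin j (suc i))              ≡⟨ cong (app u) (genWin-σ j i) ⟩
  app u (σ j (+ suc i))                 ≡⟨ nth-step j u j<k i ⟨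
  nth (step j u) i                      ∎
  where open ≡-Reasoning

step-involutive : ∀ j (u : Vec ℤ k) → j ℕ.< k → step j (step j u) ≡ u
step-involutive j u j<k = nth-ext _ _ λ i _ →
  trans (app-step j (step j u) j<k (+ suc i))
    (trans (app-step j u j<k _) (cong (app u) (σ-involutive j (+ suc i))))

step-isSignedPerm : ∀ j {u : Vec ℤ k} → j ℕ.< k → IsSignedPerm k u → IsSignedPerm k (step j u)
step-isSignedPerm {k} j {u} j<k (cl , inj , surj) = cl′ , inj′ , surj′
  where
  cl′ : ∀ a → InPM k a → InPM k (app (step j u) a)
  cl′ a p = subst (InPM k) (sym (app-step j u j<k a)) (cl _ (σ-InPM j j<k p))
  inj′ : ∀ a b → InPM k a → InPM k b → app (step j u) a ≡ app (step j u) b → a ≡ b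
  inj′ a b p q e = begin
    a             ≡⟨ σ-involutive j a ⟨
    σ j (σ j a)   ≡⟨ cong (σ j) (inj _ _ (σ-InPM j j<k p) (σ-InPM j j<k q)
                       (trans (sym (app-step j u j<k a)) (trans e (app-step j u j<k b)))) ⟩
    σ j (σ j b)   ≡⟨ σ-involutive j b ⟩
    b             ∎
    where open ≡-Reasoning
  surj′ : ∀ b → InPM k b → ∃ λ a → InPM k a × app (step j u) a ≡ b
  surj′ b q with surj b q
  ... | a , p , e = σ j a , σ-InPM j j<k p ,
    trans (app-step j u j<k (σ j a)) (trans (cong (app u) (σ-involutive j a)) e)

app-idB : ∀ {a} → InPM k a → app (idB k) a ≡ a
app-idB {a = + zero}   (a≢0 , _) = contradiction refl a≢0
app-idB {a = + suc i}  (_ , p)   = nth-tabulate< (λ i → + suc i) p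
app-idB {a = -[1+ i ]} (_ , p)   = cong -_ (nth-tabulate< (λ i → + suc i) p)

idB-isSignedPerm : ∀ k → IsSignedPerm k (idB k)
idB-isSignedPerm k =
  (λ a p → subst (InPM k) (sym (app-idB p)) p) ,
  (λ a b p q e → trans (sym (app-idB p)) (trans e (app-idB q))) ,
  (λ b q → b , q , app-idB q)

-- The length statistic

χ : ℤ → ℤ → ℕ
χ x y = if ⌊ x <? y ⌋ then 1 else 0

χ≡1 : ∀ {x y} → x < y → χ x y ≡ 1
χ≡1 {x} {y} p with x <? y
... | yes _ = refl
... | no ¬p = contradiction p ¬p

χ≡0 : ∀ {x y} → y < x → χ x y ≡ 0
χ≡0 {x} {y} p with x <? y
... | yes q = contradiction q (<-asym p)
... | no _  = refl

χ≤1 : ∀ x y → χ x y ℕ.≤ 1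
χ≤1 x y with x <? y
... | yes _ = ℕ.≤-refl
... | no _  = z≤n

-- Both sides test the symmetric condition x + y < 0.
χ-neg : ∀ x y → χ x (- y) ≡ χ y (- x)
χ-neg x y with x <? - y | y <? - x
... | yes _ | yes _ = refl
... | no _  | no _  = refl
... | yes p | no ¬q = contradiction (subst (_< - x) (neg-involutive y) (neg-mono-< p)) ¬q
... | no ¬p | yes q = contradiction (subst (_< - y) (neg-involutive x) (neg-mono-< q)) ¬p

cross : ℤ → Vec ℤ k → ℕ
cross x []      = 0
cross x (y ∷ w) = (χ y x ℕ.+ χ y (- x)) ℕ.+ cross x w

-- The number of i ≤ j with w(i) + w(j) < 0 plus the number of i < j with
-- w(j) < w(i).
invB : Vec ℤ k → ℕ
invB []      = 0
invB (x ∷ w) = χ x (- x) ℕ.+ cross x w ℕ.+ invB w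

-- The conditions `y < x` and `y < - x` trade places. Hence changing the sign of the first window
-- entry affects `invB` only through `χ x (- x)`.
cross-neg : ∀ x (w : Vec ℤ k) → cross (- x) w ≡ cross x w
cross-neg x []      = refl
cross-neg x (y ∷ w) = cong₂ ℕ._+_
  (trans (cong (λ z → χ y (- x) ℕ.+ χ y z) (neg-involutive x)) (ℕ.+-comm (χ y (- x)) (χ y x)))
  (cross-neg x w)

cross-swapAt : ∀ x a (w : Vec ℤ k) → cross x (swapAt a w) ≡ cross x w
cross-swapAt x zero    []          = refl
cross-swapAt x (suc a) []          = refl
cross-swapAt x zero    (y ∷ [])    = refl
cross-swapAt x zero    (y ∷ z ∷ w) =
  exchange (χ z x ℕ.+ χ z (- x)) (χ y x ℕ.+ χ y (- x)) (cross x w)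
  where
  exchange : ∀ a b c → a ℕ.+ (b ℕ.+ c) ≡ b ℕ.+ (a ℕ.+ c)
  exchange = solve-∀
cross-swapAt x (suc a) (y ∷ w)     = cong (χ y x ℕ.+ χ y (- x) ℕ.+_) (cross-swapAt x a w)

-- Pairs involving a third entry are merely reordered, and the condition x + y < 0 is symmetric by
-- `χ-neg`; only the comparison of the two exchanged entries changes.
invB-swapAt : ∀ a (u : Vec ℤ k) → suc a ℕ.< k → nth u a < nth u (suc a) →
  invB (swapAt a u) ≡ suc (invB u)
invB-swapAt zero (x ∷ [])    (s≤s ()) _
invB-swapAt zero (x ∷ y ∷ w) _ x<y
  rewrite χ≡1 x<y | χ≡0 x<y | χ-neg x y =
  regroup (χ y (- y)) (χ y (- x)) (cross y w) (χ x (- x)) (cross x w) (invB w)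
  where
  regroup : ∀ yy xy cy xx cx r →
    yy ℕ.+ ((1 ℕ.+ xy) ℕ.+ cy) ℕ.+ (xx ℕ.+ cx ℕ.+ r) ≡
    suc (xx ℕ.+ ((0 ℕ.+ xy) ℕ.+ cx) ℕ.+ (yy ℕ.+ cy ℕ.+ r))
  regroup = solve-∀
invB-swapAt (suc a) (x ∷ w) (s≤s p) h
  rewrite cross-swapAt x a w | invB-swapAt a w p h = ℕ.+-suc _ _

invB-step : ∀ j (u : Vec ℤ k) → j ℕ.< k → app u (lo j) < app u (hi j) →
  invB (step j u) ≡ suc (invB u)
invB-step zero (x ∷ w) _ -x<x
  rewrite neg-involutive x | χ≡1 -x<x | χ≡0 -x<x | cross-neg x w = refl
invB-step (suc a) u j<k h = invB-swapAt a u j<k h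

cross≤ : ∀ x (w : Vec ℤ k) → cross x w ℕ.≤ k ℕ.* 2
cross≤ x []      = z≤n
cross≤ x (y ∷ w) = ℕ.+-mono-≤ (ℕ.+-mono-≤ (χ≤1 y x) (χ≤1 y (- x))) (cross≤ x w)

-- This is k², the length of the longest element of B_k; it bounds the number of sorting steps.
maxInvB : ℕ → ℕ
maxInvB zero    = 0
maxInvB (suc k) = 1 ℕ.+ k ℕ.* 2 ℕ.+ maxInvB k

invB≤ : (u : Vec ℤ k) → invB u ℕ.≤ maxInvB k
invB≤ []      = z≤n
invB≤ (x ∷ w) = ℕ.+-mono-≤ (ℕ.+-mono-≤ (χ≤1 x (- x)) (cross≤ x w)) (invB≤ w)

cross-tabulate : ∀ x (f : Fin k → ℤ) → (∀ i → x < f i) → (∀ i → - x < f i) → cross x (tabulate f) ≡ 0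
cross-tabulate {zero}  x f p q = refl
cross-tabulate {suc k} x f p q
  rewrite χ≡0 (p Fin.zero) | χ≡0 (q Fin.zero) = cross-tabulate x (f ∘ Fin.suc) (p ∘ Fin.suc) (q ∘ Fin.suc)

-- The shift `c` is the generalisation needed for induction: the tail of an identity window is a
-- shifted identity window.
invB-shift : ∀ k c → invB (tabulate {n = k} (λ i → + suc (c ℕ.+ toℕ i))) ≡ 0
invB-shift zero    c = refl
invB-shift (suc k) c
  rewrite cross-tabulate (+ suc (c ℕ.+ 0)) (λ (i : Fin k) → + suc (c ℕ.+ suc (toℕ i)))
            (λ i → +<+ (s≤s (ℕ.+-monoʳ-< c (s≤s z≤n)))) (λ i → -<+)
  = trans (cong (invB {k}) (tabulate-cong (λ i → cong (+_ ∘ suc) (ℕ.+-suc c (toℕ i))))) (invB-shift k (suc c))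

invB-idB : ∀ k → invB (idB k) ≡ 0
invB-idB k = invB-shift k 0

-- The inverse permutation

pos : Vec ℤ k → ℤ → ℤ
pos {k} u a with any? (λ (i : Fin k) → nth u (toℕ i) ≟ a) | any? (λ (i : Fin k) → nth u (toℕ i) ≟ - a)
... | yes (i , _) | _           = + suc (toℕ i)
... | no _        | yes (i , _) = -[1+ toℕ i ]
-- A default, reached only for `a` outside [±k] or `u` not a signed permutation; it makes `pos`, and
-- with it `Prec`, defined and decidable on all vectors.
... | no _        | no _        = + 0

module _ {u : Vec ℤ k} (sp : IsSignedPerm k u) where

  private
    app-injective = proj₁ (proj₂ sp)

  pos-spec : ∀ {a} → InPM k a → InPM k (pos u a) × app u (pos u a) ≡ a
  pos-spec {a} pa with any? (λ (i : Fin k) → nth u (toℕ i) ≟ a) | any? (λ (i : Fin k) → nth u (toℕ i) ≟ - a)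
  ... | yes (i , e) | _           = ((λ ()) , toℕ<n i) , e
  ... | no _        | yes (i , e) = ((λ ()) , toℕ<n i) , trans (cong -_ e) (neg-involutive a)
  ... | no ¬p       | no ¬q with proj₂ (proj₂ sp) a pa
  ...   | + zero    , (x≢0 , _) , e = contradiction refl x≢0
  ...   | + suc i   , (_ , i<k) , e = contradiction (fromℕ< i<k , trans (cong (nth u) (toℕ-fromℕ< i<k)) e) ¬p
  ...   | -[1+ i ]  , (_ , i<k) , e = contradiction (fromℕ< i<k , trans (cong (nth u) (toℕ-fromℕ< i<k)) (neg-≡ e)) ¬q

  pos-InPM : ∀ {a} → InPM k a → InPM k (pos u a)
  pos-InPM = proj₁ ∘ pos-spec

  app-pos : ∀ {a} → InPM k a → app u (pos u a) ≡ a
  app-pos = proj₂ ∘ pos-spec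

  pos-unique : ∀ {a x} → InPM k x → app u x ≡ a → pos u a ≡ x
  pos-unique px refl = app-injective _ _ (pos-InPM pa) px (app-pos pa)
    where pa = proj₁ sp _ px

  pos-neg : ∀ {a} → InPM k a → pos u (- a) ≡ - pos u a
  pos-neg {a} pa = pos-unique (neg-InPM (pos-InPM pa))
    (trans (app-neg u (pos u a)) (cong -_ (app-pos pa)))

  pos-injective : ∀ {a b} → InPM k a → InPM k b → pos u a ≡ pos u b → a ≡ b
  pos-injective pa pb e = trans (sym (app-pos pa)) (trans (cong (app u) e) (app-pos pb))

pos-step : ∀ {u : Vec ℤ k} → IsSignedPerm k u → ∀ {j a} → j ℕ.< k → InPM k a →
  σ j (pos (step j u) a) ≡ pos u a
pos-step {u = u} sp {j} j<k pa = sym (pos-unique sp (σ-InPM j j<k (pos-InPM sp′ pa))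
  (trans (sym (app-step j u j<k _)) (app-pos sp′ pa)))
  where sp′ = step-isSignedPerm j j<k sp

-- Odd total orders on [±k]

record IsOddOrder (k : ℕ) (T : ℤ → ℤ → Set) : Set where
  field
    trans-T : ∀ {a b c} → InPM k a → InPM k b → InPM k c → T a b → T b c → T a c
    asym-T  : ∀ {a b} → T a b → ¬ T b a
    total-T : ∀ {a b} → InPM k a → InPM k b → a ≢ b → T a b ⊎ T b a
    odd-T   : ∀ {a b} → InPM k a → InPM k b → T a b → T (- b) (- a)

Prec : Vec ℤ k → ℤ → ℤ → Set
Prec u a b = pos u a < pos u b

prec? : (u : Vec ℤ k) → ∀ a b → Dec (Prec u a b)
prec? u a b = pos u a <? pos u b

Prec-isOddOrder : {u : Vec ℤ k} → IsSignedPerm k u → IsOddOrder k (Prec u)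
Prec-isOddOrder {u = u} sp = record
  { trans-T = λ _ _ _ → <-trans
  ; asym-T  = <-asym
  ; total-T = total
  ; odd-T   = λ pa pb p → subst₂ _<_ (sym (pos-neg sp pb)) (sym (pos-neg sp pa)) (neg-mono-< p)
  }
  where
  total : ∀ {a b} → InPM _ a → InPM _ b → a ≢ b → Prec u a b ⊎ Prec u b a
  total {a} {b} pa pb a≢b with <-cmp (pos u a) (pos u b)
  ... | tri< p _ _ = inj₁ p
  ... | tri≈ _ e _ = contradiction (pos-injective sp pa pb e) a≢b
  ... | tri> _ _ q = inj₂ q

module _ {T S : ℤ → ℤ → Set} (OT : IsOddOrder k T) (OS : IsOddOrder k S) where
  private
    module T = IsOddOrder OT
    module S = IsOddOrder OS

  -- A total relation cannot grow inside an asymmetric one, so a single inclusion of odd orders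
  -- already gives equality.
  reverse-⊆ : (∀ {a b} → InPM k a → InPM k b → T a b → S a b) →
    ∀ {a b} → InPM k a → InPM k b → S a b → T a b
  reverse-⊆ T⊆S {a} {b} pa pb s with a ≟ b
  ... | yes refl = contradiction s (S.asym-T s)
  ... | no a≢b with T.total-T pa pb a≢b
  ...   | inj₁ t = t
  ...   | inj₂ t = contradiction (T⊆S pb pa t) (S.asym-T s)

-- A strictly increasing odd self-map of [±k] is inflationary on 1, …, k;
-- applied to pos v ∘ app u and its inverse, this forces both to be the identity.
module _ {u v : Vec ℤ k} (su : IsSignedPerm k u) (sv : IsSignedPerm k v)
         (u⊆v : ∀ {a b} → InPM k a → InPM k b → Prec u a b → Prec v a b) where

  private
    φ : ℤ → ℤ
    φ x = pos v (app u x)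

    φ-mono : ∀ {x y} → InPM k x → InPM k y → x < y → φ x < φ y
    φ-mono px py x<y = u⊆v (proj₁ su _ px) (proj₁ su _ py)
      (subst₂ _<_ (sym (pos-unique su px refl)) (sym (pos-unique su py refl)) x<y)

    φ-odd : ∀ {x} → InPM k x → φ (- x) ≡ - φ x
    φ-odd {x} px = trans (cong (pos v) (app-neg u x)) (pos-neg sv (proj₁ su _ px))

  inflationary : ∀ i → i ℕ.< k → ∃ λ m → φ (+ suc i) ≡ + suc m × i ℕ.≤ m
  -- Comparing the images of -1 and 1 and using oddness gives φ(1) > 0, which starts the induction.
  inflationary zero i<k with φ (+ 1) in e | φ-mono { -[1+ 0 ]} {+ 1} ((λ ()) , i<k) ((λ ()) , i<k) -<+
  ... | + suc m  | _ = m , refl , z≤n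
  ... | + zero   | p = contradiction (subst (_< + 0) (trans (φ-odd {+ 1} ((λ ()) , i<k)) (cong -_ e)) p) λ { (+<+ ()) }
  ... | -[1+ m ] | p = contradiction (subst (_< -[1+ m ]) (trans (φ-odd {+ 1} ((λ ()) , i<k)) (cong -_ e)) p) λ ()
  inflationary (suc i) i<k with inflationary i (ℕ.<⇒≤ i<k)
  ... | m , e , i≤m with φ (+ suc (suc i)) | φ-mono {+ suc i} {+ suc (suc i)} ((λ ()) , ℕ.<⇒≤ i<k) ((λ ()) , i<k) (+<+ ℕ.≤-refl)
  ...   | + suc m′  | p = m′ , refl , ℕ.≤-trans (s≤s i≤m) (ℕ.≤-pred (ℤ.drop‿+<+ (subst (_< + suc m′) e p)))
  ...   | + zero    | p = contradiction (subst (_< + zero) e p) λ { (+<+ ()) }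
  ...   | -[1+ m′ ] | p = contradiction (subst (_< -[1+ m′ ]) e p) λ ()

Prec-unique : {u v : Vec ℤ k} → IsSignedPerm k u → IsSignedPerm k v →
  (∀ {a b} → InPM k a → InPM k b → Prec u a b → Prec v a b) → u ≡ v
Prec-unique {k} {u} {v} su sv u⊆v = nth-ext u v λ i i<k → sym (begin
    nth v i                    ≡⟨ cong (app v) (fixed i i<k) ⟨
    app v (pos v (nth u i))    ≡⟨ app-pos sv (proj₁ su (+ suc i) ((λ ()) , i<k)) ⟩
    nth u i                    ∎)
  where
  open ≡-Reasoning
  v⊆u : ∀ {a b} → InPM k a → InPM k b → Prec v a b → Prec u a b
  v⊆u = reverse-⊆ (Prec-isOddOrder su) (Prec-isOddOrder sv) u⊆v

  fixed : ∀ i → i ℕ.< k → pos v (nth u i) ≡ + suc i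
  fixed i i<k with inflationary su sv u⊆v i i<k
  ... | m , e , i≤m with inflationary sv su v⊆u m m<k
    where
    m<k : m ℕ.< k
    m<k = subst (λ z → ∣ z ∣ ℕ.≤ k) e (proj₂ (pos-InPM sv (proj₁ su (+ suc i) ((λ ()) , i<k))))
  -- Here `i ≤ m ≤ m′`, and `m′ ≡ i` because the two relabellings are mutually inverse.
  ...   | m′ , e′ , m≤m′ = trans e (cong (+_ ∘ suc) (ℕ.≤-antisym (subst (m ℕ.≤_) m′≡i m≤m′) i≤m))
    where
    m′≡i : m′ ≡ i
    m′≡i = ℕ.suc-injective (ℤ.+-injective (begin
      + suc m′                          ≡⟨ e′ ⟨
      pos u (app v (+ suc m))           ≡⟨ cong (pos u ∘ app v) e ⟨
      pos u (app v (pos v (nth u i)))   ≡⟨ cong (pos u) (app-pos sv (proj₁ su (+ suc i) ((λ ()) , i<k))) ⟩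
      pos u (nth u i)                   ≡⟨ pos-unique su ((λ ()) , i<k) refl ⟩
      + suc i                           ∎))

-- Inversions

InversionsIn : Vec ℤ k → (ℤ → ℤ → Set) → Set
InversionsIn {k} u T = ∀ {a b} → InPM k a → InPM k b → a < b → Prec u b a → T b a

-- Inversions are pairs of values, not of positions: right multiplication moves positions, so a step
-- alters a single pair of values together with its negative.
_⊑_ : Vec ℤ k → Vec ℤ k → Set
u ⊑ v = InversionsIn u (Prec v)

-- This is `σ-mono` read at the positions of `b` and `a` in `step j u`; its two exceptional cases
-- name the values standing at the exchanged positions.
Prec-step : ∀ {u : Vec ℤ k} → IsSignedPerm k u → ∀ {j a b} → j ℕ.< k → InPM k a → InPM k b →
  Prec (step j u) b a →
  Prec u b a ⊎ (b ≡ app u (hi j) × a ≡ app u (lo j)) ⊎ (b ≡ - app u (lo j) × a ≡ - app u (hi j))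
Prec-step {k} {u} sp {j} {a} {b} j<k pa pb p
  with σ-mono j (pos-InPM sp′ pb) (pos-InPM sp′ pa) p
  where sp′ = step-isSignedPerm j j<k sp
... | inj₁ q = inj₁ (subst₂ _<_ (pos-step sp j<k pb) (pos-step sp j<k pa) q)
... | inj₂ (inj₁ (eb , ea)) = inj₂ (inj₁ (at pb eb (σ-lo j) , at pa ea (σ-hi j)))
  where
  at : ∀ {c x y} → InPM k c → pos (step j u) c ≡ x → σ j x ≡ y → c ≡ app u y
  at pc refl refl = trans (sym (app-pos sp pc)) (cong (app u) (sym (pos-step sp j<k pc)))
... | inj₂ (inj₂ (eb , ea)) = inj₂ (inj₂ (at pb eb (σ-hi j) , at pa ea (σ-lo j)))
  where
  at : ∀ {c x y} → InPM k c → pos (step j u) c ≡ - x → σ j x ≡ y → c ≡ - app u y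
  at {c} {x} pc e refl = begin
    c                                   ≡⟨ app-pos sp pc ⟨
    app u (pos u c)                     ≡⟨ cong (app u) (pos-step sp j<k pc) ⟨
    app u (σ j (pos (step j u) c))      ≡⟨ cong (app u ∘ σ j) e ⟩
    app u (σ j (- x))                   ≡⟨ cong (app u) (σ-neg j x) ⟩
    app u (- σ j x)                     ≡⟨ app-neg u (σ j x) ⟩
    - app u (σ j x)                     ∎
    where open ≡-Reasoning

app-step-lo : ∀ j (u : Vec ℤ k) → j ℕ.< k → app (step j u) (lo j) ≡ app u (hi j)
app-step-lo j u j<k = trans (app-step j u j<k (lo j)) (cong (app u) (σ-lo j))

app-step-hi : ∀ j (u : Vec ℤ k) → j ℕ.< k → app (step j u) (hi j) ≡ app u (lo j)
app-step-hi j u j<k = trans (app-step j u j<k (hi j)) (cong (app u) (σ-hi j))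

app-lo≢hi : ∀ {u : Vec ℤ k} {j} → IsSignedPerm k u → j ℕ.< k → app u (lo j) ≢ app u (hi j)
app-lo≢hi {j = j} (_ , inj , _) j<k e =
  <-irrefl (inj _ _ (lo-InPM j<k) (hi-InPM j<k) e) (lo<hi j)

-- `Prec-step` is applied to the step that undoes this one. The only precedences lost are those of
-- the exchanged pair and its negative, and these were increasing in `u`, hence not inversions.
⊑-step : ∀ {u : Vec ℤ k} → IsSignedPerm k u → ∀ {j} → j ℕ.< k →
  app u (lo j) < app u (hi j) → u ⊑ step j u
⊑-step {k} {u} sp {j} j<k lo<hi {a} {b} pa pb a<b p
  with Prec-step (step-isSignedPerm j j<k sp) j<k pa pb
         (subst (λ w → Prec w b a) (sym (step-involutive j u j<k)) p)
... | inj₁ q = q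
... | inj₂ (inj₁ (refl , refl)) =
  contradiction lo<hi (<-asym (subst₂ _<_ (app-step-lo j u j<k) (app-step-hi j u j<k) a<b))
... | inj₂ (inj₂ (refl , refl)) = contradiction (neg-mono-< lo<hi)
  (<-asym (subst₂ (λ x y → - x < - y) (app-step-hi j u j<k) (app-step-lo j u j<k) a<b))

-- Sorting towards an odd total order

Ascent : (k : ℕ) → Vec ℤ k → Vec ℤ k → Set
Ascent k u v = ∃ λ j → j ℕ.< k × v ≡ step j u × invB v ≡ suc (invB u)

module _ {T : ℤ → ℤ → Set} (OT : IsOddOrder k T) {u : Vec ℤ k} (sp : IsSignedPerm k u) where
  open IsOddOrder OT
  private
    InPM-nth : ∀ {i} → i ℕ.< k → InPM k (nth u i)
    InPM-nth {i} i<k = proj₁ sp (+ suc i) ((λ ()) , i<k)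

  module _ (sorted : ∀ j → j ℕ.< k → ¬ T (app u (hi j)) (app u (lo j))) where
    private
      adjacent : ∀ j → j ℕ.< k → T (app u (lo j)) (app u (hi j))
      adjacent j j<k with total-T (proj₁ sp _ (lo-InPM j<k)) (proj₁ sp _ (hi-InPM j<k)) (app-lo≢hi sp j<k)
      ... | inj₁ t = t
      ... | inj₂ t = contradiction t (sorted j j<k)

      positive : ∀ {i j} → i ℕ.<′ j → j ℕ.< k → T (nth u i) (nth u j)
      positive {i} (ℕ.<′-base) i<k = adjacent (suc i) i<k
      positive {i} (ℕ.<′-step {n = j} p) j<k = trans-T (InPM-nth i<k) (InPM-nth (ℕ.<⇒≤ j<k)) (InPM-nth j<k)
        (positive p (ℕ.<⇒≤ j<k)) (adjacent (suc j) j<k)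
        where i<k = ℕ.<-trans (ℕ.<′⇒< p) (ℕ.<⇒≤ j<k)

      -- Generator 0 bridges positions -1 and 1. The chain is then extended on the right by
      -- neighbours and on the left by their negatives.
      mixed : ∀ i j → i ℕ.< k → j ℕ.< k → T (- nth u i) (nth u j)
      mixed zero    zero    i<k j<k = adjacent 0 i<k
      mixed zero    (suc j) i<k j<k = trans-T (neg-InPM (InPM-nth i<k)) (InPM-nth (ℕ.<⇒≤ j<k)) (InPM-nth j<k)
        (mixed zero j i<k (ℕ.<⇒≤ j<k)) (adjacent (suc j) j<k)
      mixed (suc i) j       i<k j<k =
        trans-T (neg-InPM (InPM-nth i<k)) (neg-InPM (InPM-nth (ℕ.<⇒≤ i<k))) (InPM-nth j<k)
          (odd-T (InPM-nth (ℕ.<⇒≤ i<k)) (InPM-nth i<k) (adjacent (suc i) i<k))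
          (mixed i j (ℕ.<⇒≤ i<k) j<k)

      increasing : ∀ {x y} → InPM k x → InPM k y → x < y → T (app u x) (app u y)
      increasing {+ zero}               (x≢0 , _) _  _             = contradiction refl x≢0
      increasing {y = + zero}           _ (y≢0 , _)  _             = contradiction refl y≢0
      increasing {+ suc i}  {+ suc j}   _ (_ , q) (+<+ (s≤s i<j))  = positive (ℕ.<⇒<′ i<j) q
      increasing { -[1+ i ]} {+ suc j}  (_ , p) (_ , q) _          = mixed i j p q
      increasing { -[1+ i ]} { -[1+ j ]} (_ , p) (_ , q) (-<- j<i) =
        odd-T (InPM-nth q) (InPM-nth p) (positive (ℕ.<⇒<′ j<i) p)

    sorted⇒Prec⊆ : ∀ {a b} → InPM k a → InPM k b → Prec u a b → T a b
    sorted⇒Prec⊆ pa pb p = subst₂ T (app-pos sp pa) (app-pos sp pb)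
      (increasing (pos-InPM sp pa) (pos-InPM sp pb) p)

  module _ {j} (j<k : j ℕ.< k) (t : T (app u (hi j)) (app u (lo j))) (inv⊆ : InversionsIn u T) where

    -- Were `app u (hi j)` the smaller value, the pair would already be an inversion of `u`, and `T`
    -- would order it the other way. So every sorting step is an ascent for `invB`.
    descent⇒< : app u (lo j) < app u (hi j)
    descent⇒< with <-cmp (app u (lo j)) (app u (hi j))
    ... | tri< p _ _ = p
    ... | tri≈ _ e _ = contradiction e (app-lo≢hi sp j<k)
    ... | tri> _ _ q = contradiction (inv⊆ (proj₁ sp _ (hi-InPM j<k)) (proj₁ sp _ (lo-InPM j<k)) q
      (subst₂ _<_ (sym (pos-unique sp (lo-InPM j<k) refl)) (sym (pos-unique sp (hi-InPM j<k) refl)) (lo<hi j)))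
      (asym-T t)

    descent-inversions : InversionsIn (step j u) T
    descent-inversions pa pb a<b p with Prec-step sp j<k pa pb p
    ... | inj₁ q                    = inv⊆ pa pb a<b q
    ... | inj₂ (inj₁ (refl , refl)) = t
    ... | inj₂ (inj₂ (refl , refl)) = odd-T (proj₁ sp _ (hi-InPM j<k)) (proj₁ sp _ (lo-InPM j<k)) t

module Sorting {T : ℤ → ℤ → Set} (T? : ∀ a b → Dec (T a b)) where

  descent? : (u : Vec ℤ k) → Dec (∃ λ j → j ℕ.< k × T (app u (hi j)) (app u (lo j)))
  descent? {k} u = ℕ.anyUpTo? (λ j → T? (app u (hi j)) (app u (lo j))) k

  -- Bubble sort; the first argument is fuel.
  sort : ℕ → Vec ℤ k → Vec ℤ k
  sort zero    u = u
  sort (suc f) u with descent? u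
  ... | yes (j , _) = sort f (step j u)
  ... | no _        = u

  -- Each step trades one unit of fuel for one unit of `invB`, so the bound on `f ℕ.+ invB u` is
  -- invariant; at fuel 0 it contradicts `invB≤`.
  sort-spec : IsOddOrder k T → ∀ f {u : Vec ℤ k} → IsSignedPerm k u → InversionsIn u T →
    maxInvB k ℕ.< f ℕ.+ invB u →
    IsSignedPerm k (sort f u) × (∀ {a b} → InPM k a → InPM k b → Prec (sort f u) a b → T a b) ×
    Star (Ascent k) u (sort f u)
  sort-spec OT zero    {u} sp inv⊆ p = contradiction (invB≤ u) (ℕ.<⇒≱ p)
  sort-spec {k} OT (suc f) {u} sp inv⊆ p with descent? u
  ... | no ¬d = sp , sorted⇒Prec⊆ OT sp (λ j j<k t → ¬d (j , j<k , t)) , ε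
  ... | yes (j , j<k , t)
    with eq ← invB-step j u j<k (descent⇒< OT sp j<k t inv⊆)
    with sort-spec OT f (step-isSignedPerm j j<k sp) (descent-inversions OT sp j<k t inv⊆)
           (subst (maxInvB k ℕ.<_) (sym (trans (cong (f ℕ.+_) eq) (ℕ.+-suc f (invB u)))) p)
  ...   | sp′ , sub , path = sp′ , sub , (j , j<k , refl , eq) ◅ path

  -- The identity has no inversions, so sorting may start there for any odd order. Only the decision
  -- procedure is an argument, since `SubposetIso` asks for maps defined on all vectors.
  realise : (k : ℕ) → Vec ℤ k
  realise k = sort (suc (maxInvB k)) (idB k)

  module _ (OT : IsOddOrder k T) where

    ascend : {u : Vec ℤ k} → IsSignedPerm k u → InversionsIn u T →
      ∃ λ v → IsSignedPerm k v × (∀ {a b} → InPM k a → InPM k b → Prec v a b → T a b) × Star (Ascent k) u v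
    ascend sp inv⊆ = _ , sort-spec OT (suc (maxInvB k)) sp inv⊆ (s≤s (ℕ.m≤m+n _ _))

    idB-inversions : InversionsIn (idB k) T
    idB-inversions pa pb a<b p = contradiction a<b (<-asym (subst₂ _<_ (pos-idB pb) (pos-idB pa) p))
      where
      pos-idB : ∀ {a} → InPM k a → pos (idB k) a ≡ a
      pos-idB pa = pos-unique (idB-isSignedPerm k) pa (app-idB pa)

    realise-isSignedPerm : IsSignedPerm k (realise k)
    realise-isSignedPerm = proj₁ (proj₂ (ascend (idB-isSignedPerm k) idB-inversions))

    realise⇒ : ∀ {a b} → InPM k a → InPM k b → Prec (realise k) a b → T a b
    realise⇒ = proj₁ (proj₂ (proj₂ (ascend (idB-isSignedPerm k) idB-inversions)))

    ⇒realise : ∀ {a b} → InPM k a → InPM k b → T a b → Prec (realise k) a b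
    ⇒realise = reverse-⊆ (Prec-isOddOrder realise-isSignedPerm) OT realise⇒

open Sorting

-- Inversion sets and the weak order

Ascent*⇒word : ∀ {u v : Vec ℤ k} → Star (Ascent k) u v →
  ∃ λ js → IsWord k js × foldl (λ w j → w · gen k j) u js ≡ v × length js ℕ.+ invB u ≡ invB v
Ascent*⇒word ε = [] , [] , refl , refl
Ascent*⇒word {k} {u} ((j , j<k , refl , eq) ◅ path) with Ascent*⇒word path
... | js , wd , ev , len = j ∷ js , j<k ∷ wd ,
  trans (cong (λ w → foldl (λ w j → w · gen k j) w js) (·-gen j u j<k)) ev ,
  trans (sym (ℕ.+-suc (length js) (invB u))) (trans (cong (length js ℕ.+_) (sym eq)) len)

step-cases : ∀ {u : Vec ℤ k} → IsSignedPerm k u → ∀ {j} → j ℕ.< k →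
  (app u (lo j) < app u (hi j) × invB (step j u) ≡ suc (invB u)) ⊎ invB u ≡ suc (invB (step j u))
step-cases {u = u} sp {j} j<k with <-cmp (app u (lo j)) (app u (hi j))
... | tri< p _ _ = inj₁ (p , invB-step j u j<k p)
... | tri≈ _ e _ = contradiction e (app-lo≢hi sp j<k)
... | tri> _ _ q = inj₂ (trans (sym (cong invB (step-involutive j u j<k)))
  (invB-step j (step j u) j<k (subst₂ _<_ (sym (app-step-lo j u j<k)) (sym (app-step-hi j u j<k)) q)))

-- A generator raises or lowers `invB` by exactly one, so `invB` grows at most as fast as the word.
invB-word : ∀ {u : Vec ℤ k} → IsSignedPerm k u → ∀ js → IsWord k js →
  invB (foldl (λ w j → w · gen k j) u js) ℕ.≤ length js ℕ.+ invB u
invB-word sp []       []         = ℕ.≤-refl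
invB-word {u = u} sp (j ∷ js) (j<k ∷ wd) rewrite ·-gen j u j<k =
  ℕ.≤-trans (invB-word (step-isSignedPerm j j<k sp) js wd)
    (subst (length js ℕ.+ invB (step j u) ℕ.≤_) (ℕ.+-suc (length js) (invB u)) (ℕ.+-monoʳ-≤ (length js) bound))
  where
  bound : invB (step j u) ℕ.≤ suc (invB u)
  bound with step-cases sp j<k
  ... | inj₁ (_ , e) = ℕ.≤-reflexive e
  ... | inj₂ e       = ℕ.≤-trans (ℕ.n≤1+n _) (ℕ.≤-trans (ℕ.≤-reflexive (sym e)) (ℕ.n≤1+n _))

-- Sorting `u` towards the order of `v` ends at a permutation whose order is contained in that of
-- `v`, which is then `v` itself by `Prec-unique`.
⊑⇒Ascent* : ∀ {u v : Vec ℤ k} → IsSignedPerm k u → IsSignedPerm k v → u ⊑ v → Star (Ascent k) u v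
⊑⇒Ascent* {k} {u} {v} su sv u⊑v =
  let (w , sw , w⊆v , path) = ascend (prec? v) (Prec-isOddOrder sv) su u⊑v
  in subst (Star (Ascent k) u) (Prec-unique sw sv w⊆v) path

idB-⊑ : ∀ {v : Vec ℤ k} → IsSignedPerm k v → idB k ⊑ v
idB-⊑ {v = v} sv = idB-inversions (prec? v) (Prec-isOddOrder sv)

-- The sorting path from the identity provides a word of length `invB u`, and `invB-word` makes it
-- shortest.
hasLength : ∀ {u : Vec ℤ k} → IsSignedPerm k u → HasLength k u (invB u)
hasLength {k} {u} sp =
  (let (js , wd , ev , len) = Ascent*⇒word (⊑⇒Ascent* (idB-isSignedPerm k) sp (idB-⊑ sp))
   in js , wd , ev , trans (sym (add-idB js)) len) , minimal
  where
  add-idB : ∀ js → length js ℕ.+ invB (idB k) ≡ length js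
  add-idB js = trans (cong (length js ℕ.+_) (invB-idB k)) (ℕ.+-identityʳ _)
  minimal : ∀ js → IsWord k js → evalWord k js ≡ u → invB u ℕ.≤ length js
  minimal js wd refl = subst (invB u ℕ.≤_) (add-idB js) (invB-word (idB-isSignedPerm k) js wd)

HasLength-unique : ∀ {u : Vec ℤ k} {m n} → HasLength k u m → HasLength k u n → m ≡ n
HasLength-unique ((js , wj , ej , refl) , minj) ((is , wi , ei , refl) , mini) =
  ℕ.≤-antisym (minj is wi ei) (mini js wj ej)

Ascent⇒CoverR : ∀ {u v : Vec ℤ k} → IsSignedPerm k u → Ascent k u v → CoverR k u v
Ascent⇒CoverR {k} {u} sp (j , j<k , refl , e) =
  j , j<k , sym (·-gen j u j<k) , invB u , hasLength sp ,
  subst (HasLength k (step j u)) e (hasLength (step-isSignedPerm j j<k sp))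

Ascent*⇒≤R : ∀ {u v : Vec ℤ k} → IsSignedPerm k u → Star (Ascent k) u v → ≤R k u v
Ascent*⇒≤R sp ε = ε
Ascent*⇒≤R sp (a@(j , j<k , refl , _) ◅ path) =
  Ascent⇒CoverR sp a ◅ Ascent*⇒≤R (step-isSignedPerm j j<k sp) path

⊑⇒≤R : ∀ {u v : Vec ℤ k} → IsSignedPerm k u → IsSignedPerm k v → u ⊑ v → ≤R k u v
⊑⇒≤R su sv u⊑v = Ascent*⇒≤R su (⊑⇒Ascent* su sv u⊑v)

CoverR⇒⊑ : ∀ {u v : Vec ℤ k} → IsSignedPerm k u → CoverR k u v → IsSignedPerm k v × u ⊑ v
CoverR⇒⊑ {k} {u} su (j , j<k , refl , m , lu , lv) =
  subst (λ w → IsSignedPerm k w × u ⊑ w) (sym (·-gen j u j<k)) (sv , λ {a} {b} → ascending (step-cases su j<k) {a} {b})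
  where
  sv = step-isSignedPerm j j<k su
  longer : invB (step j u) ≡ suc (invB u)
  longer = trans
    (HasLength-unique (hasLength sv) (subst (λ w → HasLength k w (suc m)) (·-gen j u j<k) lv))
    (cong suc (HasLength-unique lu (hasLength su)))
  ascending : (app u (lo j) < app u (hi j) × invB (step j u) ≡ suc (invB u)) ⊎ invB u ≡ suc (invB (step j u)) →
    u ⊑ step j u
  ascending (inj₁ (p , _)) = ⊑-step su j<k p
  -- A descent, together with the prescribed growth of the length, would give
  -- `invB u ≡ suc (suc (invB u))`.
  ascending (inj₂ e) = contradiction (trans e (cong suc longer)) (ℕ.<⇒≢ (ℕ.m≤n⇒m≤1+n ℕ.≤-refl))

≤R⇒⊑ : ∀ {u v : Vec ℤ k} → IsSignedPerm k u → ≤R k u v → u ⊑ v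
≤R⇒⊑ su ε          pa pb a<b p = p
≤R⇒⊑ su (c ◅ path) pa pb a<b p with CoverR⇒⊑ su c
... | sw , u⊑w = ≤R⇒⊑ sw path pa pb a<b (u⊑w pa pb a<b p)

-- Joins: the transitive closure of a union of inversion sets is biclosed

module Biclosed {I : ℤ → ℤ → Set}
  (I⇒<     : ∀ {a b} → I a b → a < b)
  (I-trans : ∀ {a b c} → I a b → I b c → I a c)
  (I-split : ∀ {a b c} → InPM k b → a < b → b < c → I a c → I a b ⊎ I b c)
  (I-odd   : ∀ {a b} → I a b → I (- b) (- a))
  (I?      : ∀ a b → Dec (I a b))
  where

  Inverted : ℤ → ℤ → Set
  Inverted a b = (a < b × ¬ I a b) ⊎ I b a

  inverted? : ∀ a b → Dec (Inverted a b)
  inverted? a b = (a <? b ×-dec ¬? (I? a b)) ⊎-dec I? b a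

  inverted-trans : ∀ {a b c} → InPM k a → InPM k b → InPM k c → Inverted a b → Inverted b c → Inverted a c
  inverted-trans pa pb pc (inj₁ (a<b , ¬ab)) (inj₁ (b<c , ¬bc)) =
    inj₁ (<-trans a<b b<c , λ ac → Sum.[ ¬ab , ¬bc ] (I-split pb a<b b<c ac))
  inverted-trans {a} {b} {c} pa pb pc (inj₁ (a<b , ¬ab)) (inj₂ cb) with <-cmp a c
  ... | tri< a<c _ _  = inj₁ (a<c , λ ac → ¬ab (I-trans ac cb))
  ... | tri≈ _ refl _ = contradiction cb ¬ab
  ... | tri> _ _ c<a  = inj₂ (Sum.[ id , flip contradiction ¬ab ] (I-split pa c<a a<b cb))
  inverted-trans {a} {b} {c} pa pb pc (inj₂ ba) (inj₁ (b<c , ¬bc)) with <-cmp a c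
  ... | tri< a<c _ _  = inj₁ (a<c , λ ac → ¬bc (I-trans ba ac))
  ... | tri≈ _ refl _ = contradiction ba ¬bc
  ... | tri> _ _ c<a  = inj₂ (Sum.[ flip contradiction ¬bc , id ] (I-split pc b<c c<a ba))
  inverted-trans pa pb pc (inj₂ ba) (inj₂ cb) = inj₂ (I-trans cb ba)

  inverted-asym : ∀ {a b} → Inverted a b → ¬ Inverted b a
  inverted-asym (inj₁ (a<b , _)) (inj₁ (b<a , _)) = <-asym a<b b<a
  inverted-asym (inj₁ (_ , ¬ab)) (inj₂ ab)        = ¬ab ab
  inverted-asym (inj₂ ba)        (inj₁ (_ , ¬ba)) = ¬ba ba
  inverted-asym (inj₂ ba)        (inj₂ ab)        = <-asym (I⇒< ba) (I⇒< ab)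

  inverted-total-< : ∀ {a b} → a < b → Inverted a b ⊎ Inverted b a
  inverted-total-< {a} {b} a<b with I? a b
  ... | yes ab = inj₂ (inj₂ ab)
  ... | no ¬ab = inj₁ (inj₁ (a<b , ¬ab))

  inverted-total : ∀ {a b} → a ≢ b → Inverted a b ⊎ Inverted b a
  inverted-total {a} {b} a≢b with <-cmp a b
  ... | tri< a<b _ _ = inverted-total-< a<b
  ... | tri≈ _ e _   = contradiction e a≢b
  ... | tri> _ _ b<a = Sum.swap (inverted-total-< b<a)

  inverted-odd : ∀ {a b} → Inverted a b → Inverted (- b) (- a)
  inverted-odd {a} {b} (inj₁ (a<b , ¬ab)) =
    inj₁ (neg-mono-< a<b , λ i → ¬ab (subst₂ I (neg-involutive a) (neg-involutive b) (I-odd i)))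
  inverted-odd (inj₂ ba) = inj₂ (I-odd ba)

  inverted-isOddOrder : IsOddOrder k Inverted
  inverted-isOddOrder = record
    { trans-T = inverted-trans
    ; asym-T  = inverted-asym
    ; total-T = λ _ _ → inverted-total
    ; odd-T   = λ _ _ → inverted-odd
    }

-- Deciding the transitive closure

search : {P : ℤ → Set} → (∀ a → Dec (P a)) → Dec (∃ λ a → InPM k a × P a)
search {k} {P} P? = Dec.map′ found lost (ℕ.anyUpTo? (λ i → P? (+ suc i) ⊎-dec P? -[1+ i ]) k)
  where
  found : (∃ λ i → i ℕ.< k × (P (+ suc i) ⊎ P -[1+ i ])) → ∃ λ a → InPM k a × P a
  found (i , i<k , inj₁ p) = + suc i , ((λ ()) , i<k) , p
  found (i , i<k , inj₂ p) = -[1+ i ] , ((λ ()) , i<k) , p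
  lost : (∃ λ a → InPM k a × P a) → ∃ λ i → i ℕ.< k × (P (+ suc i) ⊎ P -[1+ i ])
  lost (+ zero   , (a≢0 , _) , p) = contradiction refl a≢0
  lost (+ suc i  , (_ , i<k) , p) = i , i<k , inj₁ p
  lost (-[1+ i ] , (_ , i<k) , p) = i , i<k , inj₂ p

inPM? : ∀ k a → Dec (InPM k a)
inPM? k a = ¬? (a ≟ + 0) ×-dec (∣ a ∣ ℕ.≤? k)

-- The shift by `k` of [±k] into 0, ..., 2k; truncated subtraction is exact there.
rank : ℕ → ℤ → ℕ
rank k (+ n)    = k ℕ.+ n
rank k -[1+ n ] = k ℕ.∸ suc n

rank-mono : ∀ {a b} → InPM k a → InPM k b → a < b → rank k a ℕ.< rank k b
rank-mono {k} _       _       (+<+ m<n)   = ℕ.+-monoʳ-< k m<n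
rank-mono {k} (_ , p) _       (-<- n<m)   = ℕ.∸-monoʳ-< (s≤s n<m) p
rank-mono {k} { -[1+ m ]} {+ n} (_ , p) _ -<+ =
  ℕ.<-≤-trans (ℕ.∸-monoʳ-< {k} {suc m} {0} (s≤s z≤n) p) (ℕ.m≤m+n k n)

rank≤ : ∀ {a} → InPM k a → rank k a ℕ.≤ k ℕ.+ k
rank≤ {k} {+ n}      (_ , p) = ℕ.+-monoʳ-≤ k p
rank≤ {k} { -[1+ n ]} _      = ℕ.≤-trans (ℕ.m∸n≤m k (suc n)) (ℕ.m≤m+n k k)

module Join {u v : Vec ℤ k} (su : IsSignedPerm k u) (sv : IsSignedPerm k v) where

  -- Membership in [±k] is built in so that intermediate points of a chain stay in the finite range
  -- that is searched.
  Union : ℤ → ℤ → Set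
  Union a b = (InPM k a × InPM k b) × a < b × (Prec u b a ⊎ Prec v b a)

  union? : ∀ a b → Dec (Union a b)
  union? a b = (inPM? k a ×-dec inPM? k b) ×-dec (a <? b ×-dec (prec? u b a ⊎-dec prec? v b a))

  Closure : ℤ → ℤ → Set
  Closure = TransClosure Union

  closure⇒< : ∀ {a b} → Closure a b → a < b
  closure⇒< [ _ , a<b , _ ]      = a<b
  closure⇒< ((_ , a<b , _) ∷ bc) = <-trans a<b (closure⇒< bc)

  union-odd : ∀ {a b} → Union a b → Union (- b) (- a)
  union-odd ((pa , pb) , a<b , p) = (neg-InPM pb , neg-InPM pa) , neg-mono-< a<b ,
    Sum.map (IsOddOrder.odd-T (Prec-isOddOrder su) pb pa) (IsOddOrder.odd-T (Prec-isOddOrder sv) pb pa) p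

  closure-odd : ∀ {a b} → Closure a b → Closure (- b) (- a)
  closure-odd [ r ]    = [ union-odd r ]
  closure-odd (r ∷ rs) = closure-odd rs ∷ʳ union-odd r

  prec-split : ∀ {w} → IsSignedPerm k w → ∀ {a b c} → InPM k a → InPM k b → a < b → Prec w c a → Prec w b a ⊎ Prec w c b
  prec-split sw pa pb a<b p with IsOddOrder.total-T (Prec-isOddOrder sw) pa pb (ℤ.<⇒≢ a<b)
  ... | inj₁ q = inj₂ (<-trans p q)
  ... | inj₂ q = inj₁ q

  union-split : ∀ {a b c} → InPM k b → a < b → b < c → Union a c → Union a b ⊎ Union b c
  union-split pb a<b b<c ((pa , pc) , _ , inj₁ p) =
    Sum.map (λ q → (pa , pb) , a<b , inj₁ q) (λ q → (pb , pc) , b<c , inj₁ q) (prec-split su pa pb a<b p)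
  union-split pb a<b b<c ((pa , pc) , _ , inj₂ p) =
    Sum.map (λ q → (pa , pb) , a<b , inj₂ q) (λ q → (pb , pc) , b<c , inj₂ q) (prec-split sv pa pb a<b p)

  -- Only the link of the chain that jumps over b has to be split.
  closure-split : ∀ {a b c} → InPM k b → a < b → b < c → Closure a c → Closure a b ⊎ Closure b c
  closure-split pb a<b b<c [ r ] = Sum.map [_] [_] (union-split pb a<b b<c r)
  closure-split {b = b} pb a<b b<c (_∷_ {y = y} r rs) with <-cmp b y
  ... | tri< b<y _ _  = Sum.map [_] (_∷ rs) (union-split pb a<b b<y r)
  ... | tri≈ _ refl _ = inj₁ [ r ]
  ... | tri> _ _ y<b  = Sum.map₁ (r ∷_) (closure-split pb y<b b<c rs)

  -- Chains increase strictly and `rank` is at most 2k on [±k], so fuel for the remaining ranks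
  -- suffices. When it is exhausted, `a` lies beyond every possible starting point.
  closure-dec : ∀ n a b → k ℕ.+ k ℕ.< n ℕ.+ rank k a → Dec (Closure a b)
  closure-dec zero a b far = no λ
    { [ (pa , _) , _ ]     → ℕ.<⇒≱ far (rank≤ pa)
    ; (((pa , _) , _) ∷ _) → ℕ.<⇒≱ far (rank≤ pa) }
  closure-dec (suc n) a b far =
    Dec.map′ Sum.[ [_] , (λ { (_ , _ , r , rs) → r ∷ rs }) ]
      (λ { [ r ] → inj₁ r ; (r ∷ rs) → inj₂ (_ , proj₂ (proj₁ r) , r , rs) })
      (union? a b ⊎-dec search via?)
    where
    via? : ∀ c → Dec (Union a c × Closure c b)
    via? c with union? a c
    ... | no ¬r = no (¬r ∘ proj₁)
    -- The link is decided before the recursive call: `a < c` raises the rank and so pays for the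
    -- unit of fuel spent.
    ... | yes r@((pa , pc) , a<c , _) = Dec.map′ (r ,_) proj₂ (closure-dec n c b
      (ℕ.<-≤-trans (subst (k ℕ.+ k ℕ.<_) (sym (ℕ.+-suc n (rank k a))) far) (ℕ.+-monoʳ-≤ n (rank-mono pa pc a<c))))

  closure? : ∀ a b → Dec (Closure a b)
  closure? a b = closure-dec (suc (k ℕ.+ k)) a b (s≤s (ℕ.m≤m+n _ _))

  open Biclosed {k = k} closure⇒< _++_ closure-split closure-odd closure?

  join : Vec ℤ k
  join = realise inverted? k

  join-isSignedPerm : IsSignedPerm k join
  join-isSignedPerm = realise-isSignedPerm inverted? inverted-isOddOrder

  join-upperˡ : u ⊑ join
  join-upperˡ pa pb a<b p = ⇒realise inverted? inverted-isOddOrder pb pa (inj₂ [ (pa , pb) , a<b , inj₁ p ])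

  join-upperʳ : v ⊑ join
  join-upperʳ pa pb a<b p = ⇒realise inverted? inverted-isOddOrder pb pa (inj₂ [ (pa , pb) , a<b , inj₂ p ])

  -- The inversions of `z` contain the union and compose, because `Prec z` is transitive; hence they
  -- contain its closure.
  join-least : ∀ {z : Vec ℤ k} → u ⊑ z → v ⊑ z → join ⊑ z
  join-least {z} u⊑z v⊑z pa pb a<b p with realise⇒ inverted? inverted-isOddOrder pb pa p
  ... | inj₁ (b<a , _) = contradiction b<a (<-asym a<b)
  ... | inj₂ c         = closure⇒Prec c
    where
    union⇒Prec : ∀ {a b} → Union a b → Prec z b a
    union⇒Prec ((pa , pb) , a<b , inj₁ p) = u⊑z pa pb a<b p
    union⇒Prec ((pa , pb) , a<b , inj₂ p) = v⊑z pa pb a<b p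
    closure⇒Prec : ∀ {a b} → Closure a b → Prec z b a
    closure⇒Prec [ r ]    = union⇒Prec r
    closure⇒Prec (r ∷ rs) = <-trans (closure⇒Prec rs) (union⇒Prec r)

-- The antiautomorphism w ↦ -w

negate : Vec ℤ k → Vec ℤ k
negate = Vec.map (λ x → - x)

nth-negate : (u : Vec ℤ k) → ∀ i → nth (negate u) i ≡ - nth u i
nth-negate []      i       = refl
nth-negate (x ∷ u) zero    = refl
nth-negate (x ∷ u) (suc i) = nth-negate u i

app-negate : (u : Vec ℤ k) → ∀ x → app (negate u) x ≡ - app u x
app-negate u (+ zero)  = refl
app-negate u (+ suc i) = nth-negate u i
app-negate u -[1+ i ]  = cong -_ (nth-negate u i)

negate-involutive : (u : Vec ℤ k) → negate (negate u) ≡ u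
negate-involutive []      = refl
negate-involutive (x ∷ u) = cong₂ _∷_ (neg-involutive x) (negate-involutive u)

negate-isSignedPerm : {u : Vec ℤ k} → IsSignedPerm k u → IsSignedPerm k (negate u)
negate-isSignedPerm {k} {u} (cl , inj , surj) =
  (λ a p → subst (InPM k) (sym (app-negate u a)) (neg-InPM (cl a p))) ,
  (λ a b p q e → inj a b p q (ℤ.neg-injective (trans (sym (app-negate u a)) (trans e (app-negate u b))))) ,
  λ b q → let (a , p , e) = surj (- b) (neg-InPM q) in
    a , p , trans (app-negate u a) (sym (neg-≡ (sym e)))

module _ {u : Vec ℤ k} (su : IsSignedPerm k u) where

  pos-negate : ∀ {a} → InPM k a → pos (negate u) a ≡ - pos u a
  pos-negate {a} pa = pos-unique (negate-isSignedPerm su) (neg-InPM (pos-InPM su pa)) (begin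
    app (negate u) (- pos u a)   ≡⟨ app-negate u (- pos u a) ⟩
    - app u (- pos u a)          ≡⟨ cong -_ (app-neg u (pos u a)) ⟩
    - - app u (pos u a)          ≡⟨ neg-involutive _ ⟩
    app u (pos u a)              ≡⟨ app-pos su pa ⟩
    a                            ∎)
    where open ≡-Reasoning

  Prec⇒negate : ∀ {a b} → InPM k a → InPM k b → Prec u a b → Prec (negate u) b a
  Prec⇒negate pa pb p = subst₂ _<_ (sym (pos-negate pb)) (sym (pos-negate pa)) (neg-mono-< p)

  negate⇒Prec : ∀ {a b} → InPM k a → InPM k b → Prec (negate u) a b → Prec u b a
  negate⇒Prec pa pb p = ℤ.neg-cancel-< (subst₂ _<_ (pos-negate pa) (pos-negate pb) p)

  -- Every increasing pair is an inversion of `u` or of `negate u`, so a common upper bound inverts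
  -- them all.
  ⊑-complementary : ∀ {z : Vec ℤ k} → u ⊑ z → negate u ⊑ z → ∀ {a b} → InPM k a → InPM k b → a < b → Prec z b a
  ⊑-complementary u⊑z ū⊑z pa pb a<b
    with IsOddOrder.total-T (Prec-isOddOrder su) pa pb (ℤ.<⇒≢ a<b)
  ... | inj₁ p = ū⊑z pa pb a<b (Prec⇒negate pa pb p)
  ... | inj₂ p = u⊑z pa pb a<b p

negate-antitone : {u v : Vec ℤ k} → IsSignedPerm k u → IsSignedPerm k v → u ⊑ v → negate v ⊑ negate u
negate-antitone su sv u⊑v pa pb a<b p
  with IsOddOrder.total-T (Prec-isOddOrder su) pa pb (ℤ.<⇒≢ a<b)
... | inj₁ q = Prec⇒negate su pa pb q
... | inj₂ q = contradiction (negate⇒Prec sv pb pa p) (<-asym (u⊑v pa pb a<b q))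

negate-antitone⁻¹ : {u v : Vec ℤ k} → IsSignedPerm k u → IsSignedPerm k v → u ⊑ negate v → v ⊑ negate u
negate-antitone⁻¹ {u = u} {v} su sv p =
  subst (_⊑ negate u) (negate-involutive v) (negate-antitone su (negate-isSignedPerm sv) p)

-- Complemented lattices

signedPerm-lattice : ∀ k → IsComplementedLattice (IsSignedPerm k) (≤R k)
signedPerm-lattice k = meets , joins , idB k , top , s⊥ , s⊤ , bottom≤ , ≤top , complements
  where
  s⊥ = idB-isSignedPerm k
  top = negate (idB k)
  s⊤ = negate-isSignedPerm s⊥
  ⊑-top : ∀ {x} → IsSignedPerm k x → x ⊑ top
  ⊑-top sx = negate-antitone⁻¹ s⊥ sx (idB-⊑ (negate-isSignedPerm sx))
  bottom≤ : ∀ x → IsSignedPerm k x → ≤R k (idB k) x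
  bottom≤ x sx = ⊑⇒≤R s⊥ sx (idB-⊑ sx)
  ≤top : ∀ x → IsSignedPerm k x → ≤R k x top
  ≤top x sx = ⊑⇒≤R sx s⊤ (⊑-top sx)
  joins : ∀ x y → IsSignedPerm k x → IsSignedPerm k y → ∃ λ j → IsJoin (IsSignedPerm k) (≤R k) x y j
  joins x y sx sy = join , join-isSignedPerm ,
    ⊑⇒≤R sx join-isSignedPerm join-upperˡ , ⊑⇒≤R sy join-isSignedPerm join-upperʳ ,
    λ z sz x≤z y≤z → ⊑⇒≤R join-isSignedPerm sz (join-least (≤R⇒⊑ sx x≤z) (≤R⇒⊑ sy y≤z))
    where open Join sx sy
  meets : ∀ x y → IsSignedPerm k x → IsSignedPerm k y → ∃ λ m → IsMeet (IsSignedPerm k) (≤R k) x y m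
  meets x y sx sy = negate join , sm ,
    ⊑⇒≤R sm sx (lower sx join-upperˡ) , ⊑⇒≤R sm sy (lower sy join-upperʳ) ,
    λ z sz z≤x z≤y → ⊑⇒≤R sz sm (negate-antitone⁻¹ join-isSignedPerm sz
      (join-least (negate-antitone sz sx (≤R⇒⊑ sz z≤x)) (negate-antitone sz sy (≤R⇒⊑ sz z≤y))))
    where
    open Join (negate-isSignedPerm sx) (negate-isSignedPerm sy)
    sm = negate-isSignedPerm join-isSignedPerm
    lower : ∀ {x} → IsSignedPerm k x → negate x ⊑ join → negate join ⊑ x
    lower {x} sx p = subst (negate join ⊑_) (negate-involutive x)
      (negate-antitone (negate-isSignedPerm sx) join-isSignedPerm p)
  complements : ∀ x → IsSignedPerm k x → ∃ λ y → IsSignedPerm k y ×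
    IsMeet (IsSignedPerm k) (≤R k) x y (idB k) × IsJoin (IsSignedPerm k) (≤R k) x y top
  complements x sx = negate x , sy ,
    -- No pair is an inversion of both `x` and `negate x`, so a common lower bound has no
    -- inversions.
    (s⊥ , bottom≤ x sx , bottom≤ _ sy , λ z sz z≤x z≤y → ⊑⇒≤R sz s⊥ λ pa pb a<b p →
      contradiction (≤R⇒⊑ sz z≤x pa pb a<b p) (<-asym (negate⇒Prec sx pb pa (≤R⇒⊑ sz z≤y pa pb a<b p)))) ,
    (s⊤ , ≤top x sx , ≤top _ sy , λ z sz x≤z y≤z → ⊑⇒≤R s⊤ sz λ pa pb a<b _ →
      ⊑-complementary sx (≤R⇒⊑ sx x≤z) (≤R⇒⊑ sy y≤z) pa pb a<b)
    where sy = negate-isSignedPerm sx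

product-lattice : ∀ {k} m → IsComplementedLattice (IsSignedPerm k) (≤R k) →
  IsComplementedLattice (InProd k m) (≤Prod k m)
product-lattice m (meets , joins , bot , top , s⊥ , s⊤ , bot≤ , ≤top , complements) =
  (λ { (x , X) (y , Y) sx sy → let (z , sz , z≤x , z≤y , greatest) = meets x y sx sy in
    (z , X ∩ Y) , sz , (z≤x , p∩q⊆p X Y) , (z≤y , p∩q⊆q X Y) ,
    λ { (t , Z) st (t≤x , Z⊆X) (t≤y , Z⊆Y) → greatest t st t≤x t≤y , λ i → x∈p∩q⁺ (Z⊆X i , Z⊆Y i) } }) ,
  (λ { (x , X) (y , Y) sx sy → let (z , sz , x≤z , y≤z , least) = joins x y sx sy in
    (z , X ∪ Y) , sz , (x≤z , p⊆p∪q Y) , (y≤z , q⊆p∪q X Y) ,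
    λ { (t , Z) st (x≤t , X⊆Z) (y≤t , Y⊆Z) → least t st x≤t y≤t , λ i → Sum.[ X⊆Z , Y⊆Z ] (x∈p∪q⁻ X Y i) } }) ,
  (bot , Subset.⊥) , (top , Subset.⊤) , s⊥ , s⊤ ,
  (λ { (x , X) sx → bot≤ x sx , ⊥⊆ }) ,
  (λ { (x , X) sx → ≤top x sx , ⊆⊤ }) ,
  (λ { (x , X) sx → let (y , sy , (_ , b≤x , b≤y , greatest) , (_ , x≤t , y≤t , least)) = complements x sx in
    (y , ∁ X) , sy ,
    (s⊥ , (b≤x , ⊥⊆) , (b≤y , ⊥⊆) ,
      λ { (t , Z) st (t≤x , Z⊆X) (t≤y , Z⊆∁X) → greatest t st t≤x t≤y ,
        λ i → contradiction (Z⊆X i) (x∈∁p⇒x∉p (Z⊆∁X i)) }) ,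
    (s⊤ , (x≤t , ⊆⊤) , (y≤t , ⊆⊤) ,
      λ { (t , Z) st (x≤t , X⊆Z) (y≤t , ∁X⊆Z) → least t st x≤t y≤t ,
        λ {i} _ → Sum.[ X⊆Z , ∁X⊆Z ] (x∈p∪q⁻ X (∁ X) (subst (i ∈_) (sym (p∪∁p≡⊤ X)) ∈⊤)) }) })

-- Transport of complemented lattices along an isomorphism

module Transport {A B : Set} {P : A → Set} {_≤A_ : A → A → Set} {Q : B → Set} {_≤B_ : B → B → Set}
                 (iso : SubposetIso P _≤A_ Q _≤B_) where
  open SubposetIso iso

  private
    reflect : ∀ {a b} → P a → Q b → to a ≤B b → a ≤A from b
    reflect {a} {b} pa qb p = Equivalence.from (mono a (from b) pa (from-P b qb)) (subst (to a ≤B_) (sym (to-from b qb)) p)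

    reflect′ : ∀ {a b} → P a → Q b → b ≤B to a → from b ≤A a
    reflect′ {a} {b} pa qb p = Equivalence.from (mono (from b) a (from-P b qb) pa) (subst (_≤B to a) (sym (to-from b qb)) p)

  isMeet : ∀ {x y m} → P x → P y → IsMeet Q _≤B_ (to x) (to y) m → IsMeet P _≤A_ x y (from m)
  isMeet px py (qm , m≤x , m≤y , greatest) = from-P _ qm , reflect′ px qm m≤x , reflect′ py qm m≤y ,
    λ z pz z≤x z≤y → reflect pz qm (greatest (to z) (to-Q z pz)
      (Equivalence.to (mono z _ pz px) z≤x) (Equivalence.to (mono z _ pz py) z≤y))

  isJoin : ∀ {x y j} → P x → P y → IsJoin Q _≤B_ (to x) (to y) j → IsJoin P _≤A_ x y (from j)
  isJoin px py (qj , x≤j , y≤j , least) = from-P _ qj , reflect px qj x≤j , reflect py qj y≤j ,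
    λ z pz x≤z y≤z → reflect′ pz qj (least (to z) (to-Q z pz)
      (Equivalence.to (mono _ z px pz) x≤z) (Equivalence.to (mono _ z py pz) y≤z))

  isComplementedLattice : IsComplementedLattice Q _≤B_ → IsComplementedLattice P _≤A_
  isComplementedLattice (meets , joins , bot , top , q⊥ , q⊤ , bot≤ , ≤top , complements) =
    (λ x y px py → _ , isMeet px py (proj₂ (meets (to x) (to y) (to-Q x px) (to-Q y py)))) ,
    (λ x y px py → _ , isJoin px py (proj₂ (joins (to x) (to y) (to-Q x px) (to-Q y py)))) ,
    from bot , from top , from-P bot q⊥ , from-P top q⊤ ,
    (λ x px → reflect′ px q⊥ (bot≤ (to x) (to-Q x px))) ,
    (λ x px → reflect px q⊤ (≤top (to x) (to-Q x px))) ,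
    λ x px → let (y , qy , meet , join) = complements (to x) (to-Q x px) in
      from y , from-P y qy ,
      isMeet px (from-P y qy) (subst (λ b → IsMeet Q _≤B_ (to x) b bot) (sym (to-from y qy)) meet) ,
      isJoin px (from-P y qy) (subst (λ b → IsJoin Q _≤B_ (to x) b top) (sym (to-from y qy)) join)

-- Neighbouring positions

near⇒≤ : ∀ x y → ∣ x - y ∣ ℕ.≤ 1 → x ≤ + 1 + y
near⇒≤ x y p = subst (_≤ + 1 + y) cancel (ℤ.+-monoˡ-≤ y (ℤ.≤-trans (≤+∣∣ (x - y)) (+≤+ p)))
  where
  ≤+∣∣ : ∀ i → i ≤ + ∣ i ∣
  ≤+∣∣ (+ n)    = ℤ.≤-refl
  ≤+∣∣ -[1+ n ] = -≤+
  cancel : x - y + y ≡ x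
  cancel = trans (ℤ.+-assoc x (- y) y) (trans (cong (λ z → x + z) (ℤ.+-inverseˡ y)) (ℤ.+-identityʳ x))

near-sym : ∀ x y → ∣ x - y ∣ ℕ.≤ 1 → ∣ y - x ∣ ℕ.≤ 1
near-sym x y = subst (ℕ._≤ 1) (ℤ.∣i-j∣≡∣j-i∣ x y)

-- `y` is at least x - 1, hence at least `c`. A third position thus lies on the same side of two
-- near ones, which is why a pair behaves as one block.
near-< : ∀ {c x y} → ∣ x - y ∣ ℕ.≤ 1 → c ≢ y → c < x → c < y
near-< {c} {x} {y} p c≢y c<x = ℤ.≤∧≢⇒<
  (subst (c ≤_) (ℤ.pred-suc y) (ℤ.i<j⇒i≤pred[j] (ℤ.<-≤-trans c<x (near⇒≤ x y p)))) c≢y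

near-> : ∀ {c x y} → ∣ x - y ∣ ℕ.≤ 1 → c ≢ y → x < c → y < c
near-> {c} {x} {y} p c≢y x<c = ℤ.≤∧≢⇒<
  (ℤ.≤-trans (near⇒≤ y x (near-sym x y p)) (ℤ.i<j⇒suc[i]≤j x<c)) (c≢y ∘ sym)

near-refl : ∀ x → ∣ x - x ∣ ℕ.≤ 1
near-refl x = subst (λ z → ∣ z ∣ ℕ.≤ 1) (sym (ℤ.+-inverseʳ x)) z≤n

near-neg : ∀ x y → ∣ x - y ∣ ℕ.≤ 1 → ∣ - x - - y ∣ ℕ.≤ 1
near-neg x y = subst (ℕ._≤ 1) (trans (sym (∣-i∣≡∣i∣ (x - y))) (cong ∣_∣ (ℤ.neg-distrib-+ x (- y))))

-- Position 0 does not exist, so -1 and 1 are consecutive although not near.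
gap : ∀ {x y} → InPM k x → InPM k y → x < y → y ≢ - x → (∀ z → InPM k z → x < z → ¬ z < y) → y ≤ + 1 + x
gap {x = + zero} (x≢0 , _) _ _ _ _ = contradiction refl x≢0
gap {x = + suc m} {y} px py x<y _ empty = ℤ.≮⇒≥ λ z<y →
  empty (+ suc (suc m)) ((λ ()) , ℕ.≤-trans (ℕ.<⇒≤ (abs-< z<y)) (proj₂ py)) (+<+ ℕ.≤-refl) z<y
  where
  abs-< : ∀ {m y} → + m < y → m ℕ.< ∣ y ∣
  abs-< (+<+ p) = p
gap {x = -[1+ zero ]} {+ zero} _ (y≢0 , _) _ _ _ = contradiction refl y≢0
gap {x = -[1+ zero ]} {+ suc zero} _ _ _ y≢-x _ = contradiction refl y≢-x
gap {x = -[1+ zero ]} {+ suc (suc n)} (_ , 1≤k) _ _ _ empty =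
  contradiction (+<+ (s≤s (s≤s z≤n))) (empty (+ 1) ((λ ()) , 1≤k) -<+)
gap {x = -[1+ zero ]} { -[1+ n ]} _ _ (-<- ()) _ _
gap {x = -[1+ suc m ]} (_ , p) _ _ _ empty = ℤ.≮⇒≥
  (empty -[1+ m ] ((λ ()) , ℕ.<⇒≤ p) (-<- ℕ.≤-refl))

gap-near : ∀ {x y} → x < y → y ≤ + 1 + x → ∣ y - x ∣ ℕ.≤ 1
gap-near {x} {y} x<y y≤1+x = bounded (ℤ.i≤j⇒0≤j-i (ℤ.<⇒≤ x<y))
  (subst (y - x ≤_) (trans (ℤ.+-assoc (+ 1) x (- x)) (cong (λ z → + 1 + z) (ℤ.+-inverseʳ x))) (ℤ.+-monoˡ-≤ (- x) y≤1+x))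
  where
  bounded : ∀ {i} → + 0 ≤ i → i ≤ + 1 → ∣ i ∣ ℕ.≤ 1
  bounded (+≤+ _) (+≤+ p) = p

-- If no value stands between `a` and `b`, their positions differ by one, except that -1 and 1 are
-- consecutive at distance 2. Those two positions carry opposite values, which `b ≢ - a` rules out.
consecutive⇒near : ∀ {v : Vec ℤ k} → IsSignedPerm k v → ∀ {a b} → InPM k a → InPM k b → b ≢ - a →
  (∀ c → InPM k c → Prec v a c → ¬ Prec v c b) → (∀ c → InPM k c → Prec v b c → ¬ Prec v c a) →
  ∣ pos v a - pos v b ∣ ℕ.≤ 1
consecutive⇒near {k} {v} sv {a} {b} pa pb b≢-a ab ba with <-cmp (pos v a) (pos v b)
... | tri< p _ _ = near-sym (pos v b) (pos v a)
  (gap-near p (gap (pos-InPM sv pa) (pos-InPM sv pb) p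
    (λ e → b≢-a (pos-injective sv pb (neg-InPM pa) (trans e (sym (pos-neg sv pa)))))
    (λ z pz x<z z<y → ab (app v z) (proj₁ sv z pz)
      (subst (pos v a <_) (sym (pos-unique sv pz refl)) x<z)
      (subst (_< pos v b) (sym (pos-unique sv pz refl)) z<y))))
... | tri≈ _ e _ = subst (λ z → ∣ pos v a - z ∣ ℕ.≤ 1) e (near-refl (pos v a))
... | tri> _ _ p = gap-near p (gap (pos-InPM sv pb) (pos-InPM sv pa) p
    (λ e → b≢-a (neg-≡ (sym (pos-injective sv pa (neg-InPM pb) (trans e (sym (pos-neg sv pb)))))))
    (λ z pz x<z z<y → ba (app v z) (proj₁ sv z pz)
      (subst (pos v b <_) (sym (pos-unique sv pz refl)) x<z)
      (subst (_< pos v a) (sym (pos-unique sv pz refl)) z<y)))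

-- Blocks {2i-1, 2i}

double : ℕ → ℕ
double zero    = zero
double (suc i) = suc (suc (double i))

⌊double/2⌋ : ∀ i → ⌊ double i /2⌋ ≡ i
⌊double/2⌋ zero    = refl
⌊double/2⌋ (suc i) = cong suc (⌊double/2⌋ i)

⌊1+double/2⌋ : ∀ i → ⌊ suc (double i) /2⌋ ≡ i
⌊1+double/2⌋ zero    = refl
⌊1+double/2⌋ (suc i) = cong suc (⌊1+double/2⌋ i)

*2≡double : ∀ i → i ℕ.* 2 ≡ double i
*2≡double zero    = refl
*2≡double (suc i) = cong (suc ∘ suc) (*2≡double i)

parity : ∀ a → a ≡ double ⌊ a /2⌋ ⊎ a ≡ suc (double ⌊ a /2⌋)
parity zero          = inj₁ refl
parity (suc zero)    = inj₂ refl
parity (suc (suc a)) = Sum.map (cong (suc ∘ suc)) (cong (suc ∘ suc)) (parity a)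

double-mono : ∀ {i j} → i ℕ.< j → double i ℕ.< double j
double-mono {zero}  {suc j} _       = s≤s z≤n
double-mono {suc i} {suc j} (s≤s p) = s≤s (s≤s (double-mono p))

double<n : ∀ {i} n → i ℕ.< ⌈ n /2⌉ → double i ℕ.< n
double<n {zero}  (suc n)       _       = s≤s z≤n
double<n {suc i} (suc (suc n)) (s≤s p) = s≤s (s≤s (double<n n p))
double<n {suc i} (suc zero)    (s≤s ())

1+double<n : ∀ {i} n → i ℕ.< ⌊ n /2⌋ → suc (double i) ℕ.< n
1+double<n {zero}  (suc (suc n)) _       = s≤s (s≤s z≤n)
1+double<n {suc i} (suc (suc n)) (s≤s p) = s≤s (s≤s (1+double<n n p))

1+double<n⁻¹ : ∀ i n → suc (double i) ℕ.< n → i ℕ.< ⌊ n /2⌋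
1+double<n⁻¹ zero    (suc (suc n)) _             = s≤s z≤n
1+double<n⁻¹ zero    (suc zero)    (s≤s ())
1+double<n⁻¹ (suc i) (suc (suc n)) (s≤s (s≤s p)) = s≤s (1+double<n⁻¹ i n p)

⌊/2⌋<⌈/2⌉ : ∀ a n → a ℕ.< n → ⌊ a /2⌋ ℕ.< ⌈ n /2⌉
⌊/2⌋<⌈/2⌉ zero          (suc n)       _             = s≤s z≤n
⌊/2⌋<⌈/2⌉ (suc zero)    (suc (suc n)) _             = s≤s z≤n
⌊/2⌋<⌈/2⌉ (suc zero)    (suc zero)    (s≤s ())
⌊/2⌋<⌈/2⌉ (suc (suc a)) (suc (suc n)) (s≤s (s≤s p)) = s≤s (⌊/2⌋<⌈/2⌉ a n p)

-- Values are numbered from 1 but blocks from 0; when n is odd the last block is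
-- the singleton {n} = {odd i}.
odd even : ℕ → ℤ
odd i  = + suc (double i)
even i = + suc (suc (double i))

odd<even : ∀ i → odd i < even i
odd<even i = +<+ ℕ.≤-refl

-- `block` sends a value to its block label and `rep` is a section of it. The odd member serves as
-- representative because it exists even in a singleton last block.
rep block : ℤ → ℤ
rep (+ zero)    = + zero
rep (+ suc i)   = odd i
rep -[1+ i ]    = - odd i
block (+ zero)  = + zero
block (+ suc a) = + suc ⌊ a /2⌋
block -[1+ a ]  = -[1+ ⌊ a /2⌋ ]

rep-neg : ∀ a → rep (- a) ≡ - rep a
rep-neg (+ zero)  = refl
rep-neg (+ suc _) = refl
rep-neg -[1+ _ ]  = refl

block-neg : ∀ a → block (- a) ≡ - block a
block-neg (+ zero)  = refl
block-neg (+ suc _) = refl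
block-neg -[1+ _ ]  = refl

block-rep : ∀ a → block (rep a) ≡ a
block-rep (+ zero)  = refl
block-rep (+ suc i) = cong (+_ ∘ suc) (⌊double/2⌋ i)
block-rep -[1+ i ]  = cong -[1+_] (⌊double/2⌋ i)

block-odd : ∀ i → block (odd i) ≡ + suc i
block-odd i = cong (+_ ∘ suc) (⌊double/2⌋ i)

block-even : ∀ i → block (even i) ≡ + suc i
block-even i = cong (+_ ∘ suc) (⌊1+double/2⌋ i)

block-cases : ∀ {c i} → block c ≡ + suc i → c ≡ odd i ⊎ c ≡ even i
block-cases {+ suc a} refl = Sum.map (cong (+_ ∘ suc)) (cong (+_ ∘ suc)) (parity a)

rep-injective : ∀ {a b} → rep a ≡ rep b → a ≡ b
rep-injective {a} {b} e = trans (sym (block-rep a)) (trans (cong block e) (block-rep b))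

rep-mono : ∀ {a b} → a < b → rep a < rep b
rep-mono {+ zero}    {+ suc _}   _              = +<+ (s≤s z≤n)
rep-mono {+ zero}    {+ zero}    (+<+ ())
rep-mono {+ suc _}   {+ suc _}   (+<+ (s≤s p))  = +<+ (s≤s (double-mono p))
rep-mono { -[1+ _ ]} {+ zero}    _              = -<+
rep-mono { -[1+ _ ]} {+ suc _}   _              = -<+
rep-mono { -[1+ _ ]} { -[1+ _ ]} (-<- p)        = -<- (double-mono p)

block-mono : ∀ {a b} → a < b → block a ≢ block b → block a < block b
block-mono {+ zero}    {+ zero}    (+<+ ())
block-mono {+ zero}    {+ suc _}   _             _ = +<+ (s≤s z≤n)
block-mono {+ suc _}   {+ suc _}   (+<+ (s≤s p)) e =
  ℤ.≤∧≢⇒< (+≤+ (s≤s (ℕ.⌊n/2⌋-mono (ℕ.<⇒≤ p)))) e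
block-mono { -[1+ _ ]} {+ zero}    _             _ = -<+
block-mono { -[1+ _ ]} {+ suc _}   _             _ = -<+
block-mono { -[1+ _ ]} { -[1+ _ ]} (-<- p)       e = ℤ.≤∧≢⇒< (-≤- (ℕ.⌊n/2⌋-mono (ℕ.<⇒≤ p))) e

-- Indices past the end give `false`; for odd n this covers the singleton block, whose index is m.
mem : ∀ {m} → Subset m → ℕ → Bool
mem []      _       = false
mem (b ∷ X) zero    = b
mem (b ∷ X) (suc i) = mem X i

mem-toℕ : ∀ {m} (X : Subset m) (i : Fin m) → mem X (toℕ i) ≡ lookup X i
mem-toℕ (b ∷ X) Fin.zero    = refl
mem-toℕ (b ∷ X) (Fin.suc i) = mem-toℕ X i

flipIf : Bool → ℤ → ℤ
flipIf true  a = - a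
flipIf false a = a

flipIf-injective : ∀ b {x y} → flipIf b x ≡ flipIf b y → x ≡ y
flipIf-injective true  = ℤ.neg-injective
flipIf-injective false = id

flipIf-neg : ∀ b x → flipIf b (- x) ≡ - flipIf b x
flipIf-neg true  x = refl
flipIf-neg false x = refl

star-odd : ∀ {n} i → i ℕ.< ⌊ n /2⌋ → star n (suc (double i)) ≡ suc (suc (double i))
star-odd {n} i i<m with ⌊ suc (double i) /2⌋ ℕ.* 2 ℕ.≟ suc (double i)
... | yes e = contradiction (trans (sym (trans (cong (ℕ._* 2) (⌊1+double/2⌋ i)) (*2≡double i))) e) (ℕ.<⇒≢ ℕ.≤-refl)
... | no _ with suc (suc (double i)) ℕ.≤? n
...   | yes _ = refl
...   | no ¬p = contradiction (1+double<n n i<m) ¬p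

star-even : ∀ {n} i → star n (suc (suc (double i))) ≡ suc (double i)
star-even {n} i with ⌊ suc (suc (double i)) /2⌋ ℕ.* 2 ℕ.≟ suc (suc (double i))
... | yes _ = refl
... | no ¬e = contradiction (trans (cong (ℕ._* 2) (⌊double/2⌋ (suc i))) (*2≡double (suc i))) ¬e

<⇒≤∸1 : ∀ {a n} → a ℕ.< n → a ℕ.≤ n ℕ.∸ 1
<⇒≤∸1 (s≤s p) = p

≤∸1⇒< : ∀ {a} n → suc a ℕ.≤ n ℕ.∸ 1 → suc a ℕ.< n
≤∸1⇒< (suc n) p = s≤s p

-- Signed Wachs permutations as block permutations with flips

module Wachs (n : ℕ) where

  h m : ℕ
  h = ⌈ n /2⌉
  m = ⌊ n /2⌋

  rep-InPM : ∀ {a} → InPM h a → InPM n (rep a)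
  rep-InPM {+ zero}    (a≢0 , _) = contradiction refl a≢0
  rep-InPM {+ suc i}   (_ , p)   = (λ ()) , double<n n p
  rep-InPM { -[1+ i ]} (_ , p)   = (λ ()) , double<n n p

  block-InPM : ∀ {a} → InPM n a → InPM h (block a)
  block-InPM {+ zero}    (a≢0 , _) = contradiction refl a≢0
  block-InPM {+ suc a}   (_ , p)   = (λ ()) , ⌊/2⌋<⌈/2⌉ a n p
  block-InPM { -[1+ a ]} (_ , p)   = (λ ()) , ⌊/2⌋<⌈/2⌉ a n p

  even-InPM : ∀ {i} → i ℕ.< m → InPM n (even i)
  even-InPM p = (λ ()) , 1+double<n n p

  odd-InPM : ∀ {i} → i ℕ.< m → InPM n (odd i)
  odd-InPM p = (λ ()) , ℕ.<⇒≤ (1+double<n n p)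

  -- The Wachs condition with each pair of an `a` and its partner listed once, by two-element block,
  -- and phrased with `pos`.
  Paired : Vec ℤ n → Set
  Paired v = ∀ i → i ℕ.< m → ∣ pos v (odd i) - pos v (even i) ∣ ℕ.≤ 1

  isWachs⇒paired : ∀ {v} → IsWachs n v → Paired v
  isWachs⇒paired {v} (sv , wachs) i i<m =
    wachs (suc (double i)) (s≤s z≤n) (<⇒≤∸1 (1+double<n n i<m))
      _ _ (pos-InPM sv (odd-InPM i<m)) (pos-InPM sv (even-InPM i<m))
      (app-pos sv (odd-InPM i<m))
      (trans (app-pos sv (even-InPM i<m)) (cong +_ (sym (star-odd i i<m))))

  paired⇒isWachs : ∀ {v} → IsSignedPerm n v → Paired v → IsWachs n v
  paired⇒isWachs {v} sv paired = sv , wachs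
    where
    wachs : ∀ a → 1 ℕ.≤ a → a ℕ.≤ n ℕ.∸ 1 → ∀ x y → InPM n x → InPM n y →
      app v x ≡ + a → app v y ≡ + star n a → ∣ x - y ∣ ℕ.≤ 1
    wachs (suc c) _ c<n-1 x y px py ex ey with ⌊ c /2⌋ | parity c
    ... | i | inj₁ refl = subst₂ (λ x y → ∣ x - y ∣ ℕ.≤ 1)
        (pos-unique sv px ex) (pos-unique sv py (trans ey (cong +_ (star-odd i i<m)))) (paired i i<m)
      where
      i<m : i ℕ.< m
      i<m = 1+double<n⁻¹ i n (≤∸1⇒< n c<n-1)
    ... | i | inj₂ refl = subst₂ (λ x y → ∣ x - y ∣ ℕ.≤ 1)
        (pos-unique sv px ex) (pos-unique sv py (trans ey (cong +_ (star-even {n} i))))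
        (near-sym (pos v (odd i)) (pos v (even i)) (paired i i<m))
      where
      i<m : i ℕ.< m
      i<m = 1+double<n⁻¹ i n (ℕ.≤-trans c<n-1 (ℕ.m∸n≤m n 1))

  near-rep : ∀ {v} → IsSignedPerm n v → Paired v → ∀ {a} → InPM n a →
    ∣ pos v a - pos v (rep (block a)) ∣ ℕ.≤ 1
  near-rep sv paired {+ zero} (a≢0 , _) = contradiction refl a≢0
  near-rep {v} sv paired {+ suc c} (_ , c<n) with ⌊ c /2⌋ | parity c
  ... | i | inj₁ refl = near-refl (pos v (odd i))
  ... | i | inj₂ refl = near-sym (pos v (odd i)) (pos v (even i))
    (paired i (1+double<n⁻¹ i n c<n))
  near-rep {v} sv paired { -[1+ c ]} (_ , c<n) =
    subst₂ (λ x y → ∣ x - y ∣ ℕ.≤ 1) (sym (pos-neg sv pc)) (sym (pos-neg sv (rep-InPM (block-InPM pc))))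
      (near-neg (pos v (+ suc c)) _ (near-rep sv paired pc))
    where
    pc : InPM n (+ suc c)
    pc = (λ ()) , c<n

  -- First `a` is moved to `a′` while `b` is held fixed, then `b` to `b′` while `a′` is held fixed;
  -- this order of replacement dictates the two inequalities assumed.
  Prec-near : ∀ {v} → IsSignedPerm n v → ∀ {a a′ b b′} → InPM n a′ → InPM n b → InPM n b′ →
    ∣ pos v a - pos v a′ ∣ ℕ.≤ 1 → ∣ pos v b - pos v b′ ∣ ℕ.≤ 1 → b ≢ a′ → a′ ≢ b′ →
    Prec v a b → Prec v a′ b′
  Prec-near sv pa′ pb pb′ na nb b≢a′ a′≢b′ p =
    near-< nb (a′≢b′ ∘ pos-injective sv pa′ pb′) (near-> na (b≢a′ ∘ pos-injective sv pb pa′) p)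

  module _ {v : Vec ℤ n} (sv : IsSignedPerm n v) (paired : Paired v)
           {a b : ℤ} (pa : InPM n a) (pb : InPM n b) (a≁b : block a ≢ block b) where
    private
      pa′ = rep-InPM (block-InPM pa)
      pb′ = rep-InPM (block-InPM pb)

    Prec⇒Prec-rep : Prec v a b → Prec v (rep (block a)) (rep (block b))
    Prec⇒Prec-rep = Prec-near sv pa′ pb pb′ (near-rep sv paired pa) (near-rep sv paired pb)
      (λ e → a≁b (sym (trans (cong block e) (block-rep (block a)))))
      (a≁b ∘ rep-injective)

    Prec-rep⇒Prec : Prec v (rep (block a)) (rep (block b)) → Prec v a b
    Prec-rep⇒Prec = Prec-near sv pa pb′ pb (near-sym (pos v a) _ (near-rep sv paired pa)) (near-sym (pos v b) _ (near-rep sv paired pb))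
      (λ e → a≁b (trans (cong block (sym e)) (block-rep (block b))))
      (a≁b ∘ cong block)

  index : ℤ → ℕ
  index a = ℕ.pred ∣ block a ∣

  -- An increasing pair inside a block, either positive or the negative of such a pair. The index
  -- lies in `Fin m`, so that it can be looked up in a subset.
  record Pair (a b : ℤ) : Set where
    constructor pair
    field
      i     : Fin m
      at    : index a ≡ toℕ i
      cases : (a ≡ odd (toℕ i) × b ≡ even (toℕ i)) ⊎ (a ≡ - even (toℕ i) × b ≡ - odd (toℕ i))

  block-pair⁺ : ∀ {j a b} → block a ≡ + suc j → block b ≡ + suc j → InPM n b → a < b →
    ∃ λ (i : Fin m) → j ≡ toℕ i × a ≡ odd (toℕ i) × b ≡ even (toℕ i)
  block-pair⁺ {j} ea eb pb a<b with block-cases ea | block-cases eb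
  ... | inj₁ refl | inj₁ refl = contradiction a<b (<-irrefl refl)
  ... | inj₂ refl | inj₂ refl = contradiction a<b (<-irrefl refl)
  ... | inj₂ refl | inj₁ refl = contradiction a<b (<-asym (odd<even j))
  ... | inj₁ refl | inj₂ refl = fromℕ< j<m , sym (toℕ-fromℕ< j<m) ,
      cong odd (sym (toℕ-fromℕ< j<m)) , cong even (sym (toℕ-fromℕ< j<m))
    -- That `even j` lies in [±n] is what separates a full block from the singleton one.
    where j<m = 1+double<n⁻¹ j n (proj₂ pb)

  block-pair : ∀ {a b} → InPM n a → InPM n b → block a ≡ block b → a < b → Pair a b
  block-pair {+ zero} (a≢0 , _) = contradiction refl a≢0
  block-pair {+ suc a} pa pb e a<b with block-pair⁺ refl (sym e) pb a<b
  ... | i , at , ea , eb = pair i at (inj₁ (ea , eb))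
  block-pair { -[1+ a ]} {b} pa pb e a<b
    with block-pair⁺ { ⌊ a /2⌋} (trans (block-neg b) (cong -_ (sym e))) refl (neg-InPM pa) (neg-mono-< a<b)
  ... | i , at , eb , ea = pair i at (inj₂ (neg-≡ ea , neg-≡ eb))

  module _ {v : Vec ℤ n} (sv : IsSignedPerm n v) {a b : ℤ} (p : Pair a b) where
    open Pair p
    private
      podd  = odd-InPM (toℕ<n i)
      peven = even-InPM (toℕ<n i)

    pair⇒ : Prec v b a → Prec v (even (toℕ i)) (odd (toℕ i))
    pair⇒ q with cases
    ... | inj₁ (ea , eb) = subst₂ (Prec v) eb ea q
    ... | inj₂ (ea , eb) = IsOddOrder.odd-T (Prec-isOddOrder sv) (neg-InPM podd) (neg-InPM peven)
      (subst₂ (Prec v) eb ea q)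

    pair⇐ : Prec v (even (toℕ i)) (odd (toℕ i)) → Prec v b a
    pair⇐ q with cases
    ... | inj₁ (ea , eb) = subst₂ (Prec v) (sym eb) (sym ea) q
    ... | inj₂ (ea , eb) = subst₂ (Prec v) (sym eb) (sym ea)
      (IsOddOrder.odd-T (Prec-isOddOrder sv) peven podd q)

  -- The two maps and their inverse laws

  toOrder? : (v : Vec ℤ n) → ∀ a b → Dec (Prec v (rep a) (rep b))
  toOrder? v a b = prec? v (rep a) (rep b)

  toPerm : Vec ℤ n → Vec ℤ h
  toPerm v = realise (toOrder? v) h

  flipped? : (v : Vec ℤ n) (i : Fin m) → Dec (Prec v (even (toℕ i)) (odd (toℕ i)))
  flipped? v i = prec? v (even (toℕ i)) (odd (toℕ i))

  toSubset : Vec ℤ n → Subset m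
  toSubset v = tabulate (does ∘ flipped? v)

  -- Comparing negatives reverses the order inside a flipped block. The index ignores signs, so the
  -- resulting order is odd.
  side : Subset m → ℤ → ℤ
  side X a = flipIf (mem X (index a)) a

  Lex : Vec ℤ h → Subset m → ℤ → ℤ → Set
  Lex w X a b = Prec w (block a) (block b) ⊎ (block a ≡ block b × side X a < side X b)

  lex? : ∀ w X a b → Dec (Lex w X a b)
  lex? w X a b = prec? w (block a) (block b) ⊎-dec (block a ≟ block b ×-dec side X a <? side X b)

  fromPair : Vec ℤ h × Subset m → Vec ℤ n
  fromPair (w , X) = realise (lex? w X) n

  toOrder-isOddOrder : ∀ {v} → IsSignedPerm n v → IsOddOrder h (λ a b → Prec v (rep a) (rep b))
  toOrder-isOddOrder {v} sv = record
    { trans-T = λ _ _ _ → <-trans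
    ; asym-T  = <-asym
    ; total-T = λ pa pb a≢b → V.total-T (rep-InPM pa) (rep-InPM pb) (a≢b ∘ rep-injective)
    ; odd-T   = λ {a} {b} pa pb p → subst₂ (Prec v) (sym (rep-neg b)) (sym (rep-neg a))
                  (V.odd-T (rep-InPM pa) (rep-InPM pb) p)
    }
    where module V = IsOddOrder (Prec-isOddOrder sv)

  side-injective : ∀ X {a b} → block a ≡ block b → side X a ≡ side X b → a ≡ b
  side-injective X {a} {b} e s = flipIf-injective (mem X (index a))
    (trans s (cong (λ c → flipIf (mem X (ℕ.pred ∣ c ∣)) b) (sym e)))

  side-neg : ∀ X a → side X (- a) ≡ - side X a
  side-neg X a = trans (cong (λ j → flipIf (mem X (ℕ.pred j)) (- a))
      (trans (cong ∣_∣ (block-neg a)) (∣-i∣≡∣i∣ (block a))))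
    (flipIf-neg (mem X (index a)) a)

  lex-isOddOrder : ∀ {w} X → IsSignedPerm h w → IsOddOrder n (Lex w X)
  lex-isOddOrder {w} X sw = record
    { trans-T = λ _ _ _ → lex-trans
    ; asym-T  = lex-asym
    ; total-T = lex-total
    ; odd-T   = lex-odd
    }
    where
    module W = IsOddOrder (Prec-isOddOrder sw)
    lex-trans : ∀ {a b c} → Lex w X a b → Lex w X b c → Lex w X a c
    lex-trans (inj₁ p)       (inj₁ q)       = inj₁ (<-trans p q)
    lex-trans {a} (inj₁ p)   (inj₂ (e , _)) = inj₁ (subst (Prec w (block a)) e p)
    lex-trans {c = c} (inj₂ (e , _)) (inj₁ q) = inj₁ (subst (λ x → Prec w x (block c)) (sym e) q)
    lex-trans (inj₂ (e , p)) (inj₂ (f , q)) = inj₂ (trans e f , <-trans p q)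
    lex-asym : ∀ {a b} → Lex w X a b → ¬ Lex w X b a
    lex-asym (inj₁ p)       (inj₁ q)       = <-asym p q
    lex-asym (inj₁ p)       (inj₂ (e , _)) = <-irrefl (cong (pos w) (sym e)) p
    lex-asym (inj₂ (e , _)) (inj₁ q)       = <-irrefl (cong (pos w) (sym e)) q
    lex-asym (inj₂ (_ , p)) (inj₂ (_ , q)) = <-asym p q
    lex-total : ∀ {a b} → InPM n a → InPM n b → a ≢ b → Lex w X a b ⊎ Lex w X b a
    lex-total {a} {b} pa pb a≢b with block a ≟ block b
    ... | no a≁b = Sum.map inj₁ inj₁ (W.total-T (block-InPM pa) (block-InPM pb) a≁b)
    ... | yes e with <-cmp (side X a) (side X b)
    ...   | tri< p _ _ = inj₁ (inj₂ (e , p))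
    ...   | tri≈ _ s _ = contradiction (side-injective X e s) a≢b
    ...   | tri> _ _ q = inj₂ (inj₂ (sym e , q))
    lex-odd : ∀ {a b} → InPM n a → InPM n b → Lex w X a b → Lex w X (- b) (- a)
    lex-odd {a} {b} pa pb (inj₁ p) = inj₁ (subst₂ (Prec w) (sym (block-neg b)) (sym (block-neg a))
      (W.odd-T (block-InPM pa) (block-InPM pb) p))
    lex-odd {a} {b} pa pb (inj₂ (e , p)) =
      inj₂ (trans (block-neg b) (trans (cong -_ (sym e)) (sym (block-neg a))) ,
            subst₂ _<_ (sym (side-neg X b)) (sym (side-neg X a)) (neg-mono-< p))

  module _ {v : Vec ℤ n} (sv : IsSignedPerm n v) where

    toPerm-isSignedPerm : IsSignedPerm h (toPerm v)
    toPerm-isSignedPerm = realise-isSignedPerm (toOrder? v) (toOrder-isOddOrder sv)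

    toPerm⇒ : ∀ {a b} → InPM h a → InPM h b → Prec (toPerm v) a b → Prec v (rep a) (rep b)
    toPerm⇒ = realise⇒ (toOrder? v) (toOrder-isOddOrder sv)

    ⇒toPerm : ∀ {a b} → InPM h a → InPM h b → Prec v (rep a) (rep b) → Prec (toPerm v) a b
    ⇒toPerm = ⇒realise (toOrder? v) (toOrder-isOddOrder sv)

  module _ {w : Vec ℤ h} (X : Subset m) (sw : IsSignedPerm h w) where

    private v = fromPair (w , X)

    fromPair-isSignedPerm : IsSignedPerm n v
    fromPair-isSignedPerm = realise-isSignedPerm (lex? w X) (lex-isOddOrder X sw)

    fromPair⇒ : ∀ {a b} → InPM n a → InPM n b → Prec v a b → Lex w X a b
    fromPair⇒ = realise⇒ (lex? w X) (lex-isOddOrder X sw)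

    ⇒fromPair : ∀ {a b} → InPM n a → InPM n b → Lex w X a b → Prec v a b
    ⇒fromPair = ⇒realise (lex? w X) (lex-isOddOrder X sw)

    -- A block is an interval of the lexicographic order; this makes its two members consecutive in
    -- the permutation.
    lex-between : ∀ {a b c} → block a ≡ block b → Lex w X a c → Lex w X c b → block c ≡ block a
    lex-between e (inj₁ p) (inj₁ q) = contradiction (subst (Prec w _) (sym e) q) (<-asym p)
    lex-between e (inj₁ p) (inj₂ (f , _)) = contradiction p (<-irrefl (cong (pos w) (trans e (sym f))))
    lex-between e (inj₂ (f , _)) _ = sym f

    fromPair-paired : Paired v
    fromPair-paired i i<m = consecutive⇒near fromPair-isSignedPerm (odd-InPM i<m) (even-InPM i<m) (λ ())
      (λ c pc p q → nothing-between c (trans (lex-between (trans (block-odd i) (sym (block-even i)))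
          (fromPair⇒ (odd-InPM i<m) pc p) (fromPair⇒ pc (even-InPM i<m) q)) (block-odd i))
        (λ { refl → <-irrefl refl p }) (λ { refl → <-irrefl refl q }))
      (λ c pc p q → nothing-between c (trans (lex-between (trans (block-even i) (sym (block-odd i)))
          (fromPair⇒ (even-InPM i<m) pc p) (fromPair⇒ pc (odd-InPM i<m) q)) (block-even i))
        (λ { refl → <-irrefl refl q }) (λ { refl → <-irrefl refl p }))
      where
      nothing-between : ∀ c → block c ≡ + suc i → c ≢ odd i → c ≢ even i → ⊥
      nothing-between c e c≢odd c≢even = Sum.[ c≢odd , c≢even ] (block-cases e)

    toPerm-fromPair : toPerm v ≡ w
    toPerm-fromPair = sym (Prec-unique sw (toPerm-isSignedPerm fromPair-isSignedPerm) λ {a} {b} pa pb p →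
      ⇒toPerm fromPair-isSignedPerm pa pb (⇒fromPair (rep-InPM pa) (rep-InPM pb)
        (inj₁ (subst₂ (Prec w) (sym (block-rep a)) (sym (block-rep b)) p))))

    toSubset-fromPair : toSubset v ≡ X
    toSubset-fromPair = trans (tabulate-cong agree) (tabulate∘lookup X)
      where
      module _ (i : Fin m) where
        private
          o = odd (toℕ i)
          e = even (toℕ i)
          po = odd-InPM (toℕ<n i)
          pe = even-InPM (toℕ<n i)
        side-at : ∀ {a} → block a ≡ + suc (toℕ i) → side X a ≡ flipIf (lookup X i) a
        side-at {a} q = cong (λ b → flipIf b a)
          (trans (cong (λ c → mem X (ℕ.pred ∣ c ∣)) q) (mem-toℕ X i))
        same : block e ≡ block o
        same = trans (block-even (toℕ i)) (sym (block-odd (toℕ i)))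
        by-side : flipIf (lookup X i) e < flipIf (lookup X i) o → Prec v e o
        by-side p = ⇒fromPair pe po (inj₂ (same ,
          subst₂ _<_ (sym (side-at (block-even (toℕ i)))) (sym (side-at (block-odd (toℕ i)))) p))
        by-side′ : flipIf (lookup X i) o < flipIf (lookup X i) e → ¬ Prec v e o
        by-side′ p = <-asym (⇒fromPair po pe (inj₂ (sym same ,
          subst₂ _<_ (sym (side-at (block-odd (toℕ i)))) (sym (side-at (block-even (toℕ i)))) p)))
        agree : does (flipped? v i) ≡ lookup X i
        -- Both implications are abstracted along with the bit, so that `flipIf` computes in their
        -- hypotheses and they become comparisons of `odd` and `even` or of their negatives.
        agree with lookup X i | by-side | by-side′
        ... | true  | y | _ = dec-true (flipped? v i) (y (neg-mono-< (odd<even (toℕ i))))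
        ... | false | _ | f = dec-false (flipped? v i) (f (odd<even (toℕ i)))

  mem-toSubset : ∀ v (i : Fin m) → mem (toSubset v) (toℕ i) ≡ does (flipped? v i)
  mem-toSubset v i = trans (mem-toℕ (toSubset v) i) (lookup∘tabulate (does ∘ flipped? v) i)

  module _ {v : Vec ℤ n} (wv : IsWachs n v) where
    private
      sv = proj₁ wv
      X = toSubset v

    -- The subset read off from `v` reproduces the order of `v` inside each block: the bit of the
    -- block is whether `even` precedes `odd`, and oddness carries this over to the negative block.
    side-paired : ∀ {a b} → InPM n a → InPM n b → block a ≡ block b → a < b →
      (Prec v a b → side X a < side X b) × (Prec v b a → side X b < side X a)
    side-paired {a} {b} pa pb e a<b with block-pair pa pb e a<b
    ... | p@(pair i at _) = unflipped , flipped
      where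
      at′ : index b ≡ toℕ i
      at′ = trans (cong (ℕ.pred ∘ ∣_∣) (sym e)) at
      side-at : ∀ {c t} → index c ≡ toℕ i → does (flipped? v i) ≡ t → side X c ≡ flipIf t c
      side-at {c} at d = cong (λ b → flipIf b c) (trans (cong (mem X) at) (trans (mem-toSubset v i) d))
      unflipped : Prec v a b → side X a < side X b
      unflipped q = subst₂ _<_ (sym (side-at at d)) (sym (side-at at′ d)) a<b
        where d = dec-false (flipped? v i) λ r → <-asym q (pair⇐ sv p r)
      flipped : Prec v b a → side X b < side X a
      flipped q = subst₂ _<_ (sym (side-at at′ d)) (sym (side-at at d)) (neg-mono-< a<b)
        where d = dec-true (flipped? v i) (pair⇒ sv p q)

    Prec⇒Lex : ∀ {a b} → InPM n a → InPM n b → Prec v a b → Lex (toPerm v) X a b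
    Prec⇒Lex {a} {b} pa pb p with block a ≟ block b
    ... | no a≁b = inj₁ (⇒toPerm sv (block-InPM pa) (block-InPM pb)
      (Prec⇒Prec-rep sv (isWachs⇒paired wv) pa pb a≁b p))
    ... | yes e with <-cmp a b
    ...   | tri< a<b _ _  = inj₂ (e , proj₁ (side-paired pa pb e a<b) p)
    ...   | tri≈ _ refl _ = contradiction p (<-irrefl refl)
    ...   | tri> _ _ b<a  = inj₂ (e , proj₂ (side-paired pb pa (sym e) b<a) p)

    fromPair-to : fromPair (toPerm v , toSubset v) ≡ v
    fromPair-to = sym (Prec-unique sv (fromPair-isSignedPerm X (toPerm-isSignedPerm sv)) λ pa pb p →
      ⇒fromPair X (toPerm-isSignedPerm sv) pa pb (Prec⇒Lex pa pb p))

  ∈-toSubset⇒ : ∀ v {i} → i ∈ toSubset v → Prec v (even (toℕ i)) (odd (toℕ i))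
  ∈-toSubset⇒ v {i} p with flipped? v i | trans (sym (lookup∘tabulate (does ∘ flipped? v) i)) ([]=⇒lookup p)
  ... | yes q | _ = q
  ... | no _  | ()

  ⇒∈-toSubset : ∀ v {i} → Prec v (even (toℕ i)) (odd (toℕ i)) → i ∈ toSubset v
  ⇒∈-toSubset v {i} p = lookup⇒[]= i _ (trans (lookup∘tabulate (does ∘ flipped? v) i) (dec-true (flipped? v i) p))

  -- Comparison of the two orders

  module _ {v v′ : Vec ℤ n} (wv : IsWachs n v) (wv′ : IsWachs n v′) where
    private
      sv  = proj₁ wv
      sv′ = proj₁ wv′

    toPerm-mono : v ⊑ v′ → toPerm v ⊑ toPerm v′
    toPerm-mono v⊑v′ pa pb a<b p = ⇒toPerm sv′ pb pa
      (v⊑v′ (rep-InPM pa) (rep-InPM pb) (rep-mono a<b) (toPerm⇒ sv pb pa p))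

    toSubset-mono : v ⊑ v′ → toSubset v ⊆ toSubset v′
    toSubset-mono v⊑v′ {i} p = ⇒∈-toSubset v′
      (v⊑v′ (odd-InPM (toℕ<n i)) (even-InPM (toℕ<n i)) (odd<even (toℕ i)) (∈-toSubset⇒ v p))

    -- An inversion across blocks is visible on representatives, and `block-mono` makes it an
    -- inversion of the block permutation; an inversion within a block is a flip recorded by the
    -- subset.
    to-cancel : toPerm v ⊑ toPerm v′ → toSubset v ⊆ toSubset v′ → v ⊑ v′
    to-cancel w⊑w′ X⊆X′ {a} {b} pa pb a<b p with block a ≟ block b
    ... | no a≁b = Prec-rep⇒Prec sv′ (isWachs⇒paired wv′) pb pa (a≁b ∘ sym)
      (toPerm⇒ sv′ (block-InPM pb) (block-InPM pa)
        (w⊑w′ (block-InPM pa) (block-InPM pb) (block-mono a<b a≁b)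
          (⇒toPerm sv (block-InPM pb) (block-InPM pa)
            (Prec⇒Prec-rep sv (isWachs⇒paired wv) pb pa (a≁b ∘ sym) p))))
    ... | yes e = pair⇐ sv′ q (∈-toSubset⇒ v′ (X⊆X′ (⇒∈-toSubset v (pair⇒ sv q p))))
      where q = block-pair pa pb e a<b

  wachsIso : SubposetIso (IsWachs n) (≤R n) (InProd h m) (≤Prod h m)
  wachsIso = record
    { to      = λ v → toPerm v , toSubset v
    ; from    = fromPair
    ; to-Q    = λ v wv → toPerm-isSignedPerm (proj₁ wv)
    ; from-P  = λ (w , X) sw → paired⇒isWachs (fromPair-isSignedPerm X sw) (fromPair-paired X sw)
    ; from-to = λ v wv → fromPair-to wv
    ; to-from = λ (w , X) sw → cong₂ _,_ (toPerm-fromPair X sw) (toSubset-fromPair X sw)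
    ; mono    = λ v v′ wv wv′ → mk⇔ (preserves wv wv′) (reflects wv wv′)
    }
    where
    preserves : ∀ {v v′} → IsWachs n v → IsWachs n v′ → ≤R n v v′ →
      ≤Prod h m (toPerm v , toSubset v) (toPerm v′ , toSubset v′)
    preserves wv@(sv , _) wv′@(sv′ , _) v≤v′ =
      ⊑⇒≤R (toPerm-isSignedPerm sv) (toPerm-isSignedPerm sv′) (toPerm-mono wv wv′ (≤R⇒⊑ sv v≤v′)) ,
      toSubset-mono wv wv′ (≤R⇒⊑ sv v≤v′)
    reflects : ∀ {v v′} → IsWachs n v → IsWachs n v′ →
      ≤Prod h m (toPerm v , toSubset v) (toPerm v′ , toSubset v′) → ≤R n v v′
    reflects wv@(sv , _) wv′@(sv′ , _) (w≤w′ , X⊆X′) =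
      ⊑⇒≤R sv sv′ (to-cancel wv wv′ (≤R⇒⊑ (toPerm-isSignedPerm sv) w≤w′) X⊆X′)

theorem5p1 : (n : ℕ) → 0 ℕ.< n →
    SubposetIso (IsWachs n) (≤R n)
    (InProd ⌈ n /2⌉ ⌊ n /2⌋) (≤Prod ⌈ n /2⌉ ⌊ n /2⌋)
    × IsComplementedLattice (IsWachs n) (≤R n)
theorem5p1 n _ = wachsIso , Transport.isComplementedLattice wachsIso (product-lattice ⌊ n /2⌋ (signedPerm-lattice ⌈ n /2⌉))
  where open Wachs n
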